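{- For all integers $n,m\ge 1$, the grid $G=P_n\Box P_m$ satisfies $\mathrm{pind}(A_G)=1$, and hence $G$ is $(2,2)$-choosable.
   Context: Graphs are finite and simple. The grid $P_n\Box P_m$ is the Cartesian product of two paths: its vertex set is $\{(i,j):1\le i\le n,\ 1\le j\le m\}$ and its edge set is $\{(i,j)(i',j'): i=i',\,j'=j+1\ \text{or}\ i'=i+1,\,j'=j\}$. The matrix $A_G$: fix an orientation of $G$. $A_G$ is the real matrix with rows indexed by $E(G)$ and columns indexed by $V(G)\cup E(G)$, where for an edge $e$ oriented from $a$ to $b$: $A_G[e,z]=1$ if $z=b$ or $z\neq e$ is an edge incident to $b$; $A_G[e,z]=-1$ if $z=a$ or $z\ne e$ is an edge incident to $a$; and $A_G[e,z]=0$ otherwise. (Changing the orientation only multiplies rows by $-1$, so the notion below does not depend on it.) The permanent of an $m\times m$ matrix $A$ is $\mathrm{per}(A)=\sum_{\sigma\in S_m}\prod_{i=1}^m A[i,\sigma(i)]$ (the empty matrix has permanent $1$). The permanent index $\mathrm{pind}(A)$ of a matrix $A$ is the minimum positive integer $k$ such that there is a square matrix $A'$ (with the same rows as $A$) with $\mathrm{per}(A')\ne0$, each column of $A'$ is a column of $A$, and each column of $A$ (identified by its column index) occurs in $A'$ at most $k$ times; if no such $k$ exists, $\mathrm{pind}(A)=\infty$. A total weighting of $G$ is a map $f:V(G)\cup E(G)\to\mathbb{R}$; the vertex sum of $v$ is $\phi_f(v)=f(v)+\sum_{e\in E(v)}f(e)$, where $E(v)$ is the set of edges incident to $v$. It is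 proper if $\phi_f(u)\neq\phi_f(v)$ for every edge $uv$ of $G$. $G$ is $(k,k')$-choosable if for every assignment $L$ of a set $L(v)$ of $k$ real numbers to each vertex $v$ and a set $L(e)$ of $k'$ real numbers to each edge $e$, there is a proper total weighting $f$ with $f(z)\in L(z)$ for all $z\in V(G)\cup E(G)$. -}

module Defs where

open import Data.Bool using (if_then_else_)
open import Data.Nat as ℕ using (ℕ; zero; suc; pred; _≤_; _⊔_; _!)
import Data.Nat.Properties as ℕₚ
open import Data.Integer as ℤ using (ℤ; 0ℤ; 1ℤ; -1ℤ)
open import Data.Rational as ℚ using (ℚ; 0ℚ; ½)
import Data.Rational.Properties as ℚₚ
open import Data.Fin using (Fin; zero; suc; toℕ; inject₁; punchIn)
import Data.Fin.Properties as Finₚ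
open import Data.Fin.Permutation 
  using (Permutation′; _⟨$⟩ʳ_; insert; remove; insert-remove)
  renaming (id to idₚ; _≈_ to _≈ₚ_)
open import Data.List using (List; []; _∷_; map; foldr; filter; length; allFin; concatMap)
open import Data.List.Properties using (length-++; length-map; length-tabulate)
open import Data.List.Membership.Propositional.Properties using (∈-allFin)
open import Data.List.Relation.Unary.Any as Any using (Any; here)
import Data.List.Relation.Unary.Any.Properties as Anyₚ
open import Data.Product using (Σ; ∃; ∃-syntax; _×_; _,_; proj₁; proj₂; swap)
open import Data.Product.Function.NonDependent.Propositional using (_×-cong_)
open import Data.Sum using (_⊎_; inj₁; inj₂)
open import Data.Sum.Function.Propositional using (_⊎-cong_)
import Data.Sum.Properties as Sumₚ
open import Axiom.UniquenessOfIdentityProofs using (module Decidable⇒UIP)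
open import Function.Base using (_∘_)
open import Function.Bundles using (_↔_; mk↔ₛ′; Inverse)
open import Function.Properties.Inverse using (↔⇒↣; ↔-refl; ↔-sym; ↔-trans)
open import Relation.Binary.Definitions using (DecidableEquality)
open import Relation.Binary.PropositionalEquality
  using (_≡_; _≢_; refl; sym; trans; cong; cong₂; subst; module ≡-Reasoning)
open import Relation.Nullary using (¬_; Dec; does; contradiction)
open import Relation.Nullary.Decidable using (_⊎-dec_)

-- Cauchy sequences of rationals. Equality of reals is _≃_, and distinctness
-- is the constructive apartness _#_ (classically the negation of _≃_).
record ℝ : Set where
  constructor mkℝ
  field
    seq    : ℕ → ℚ
    cauchy : ∀ ε → 0ℚ ℚ.< ε →
             ∃[ N ] ∀ m n → N ≤ m → N ≤ n → ℚ.∣ seq m ℚ.- seq n ∣ ℚ.< ε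

open ℝ public

infix 4 _≃_ _#_
infixl 6 _+ℝ_

_≃_ : ℝ → ℝ → Set
x ≃ y = ∀ ε → 0ℚ ℚ.< ε → ∃[ N ] ∀ n → N ≤ n → ℚ.∣ seq x n ℚ.- seq y n ∣ ℚ.< ε

_#_ : ℝ → ℝ → Set
x # y = ∃[ ε ] (0ℚ ℚ.< ε × ∃[ N ] ∀ n → N ≤ n → ε ℚ.≤ ℚ.∣ seq x n ℚ.- seq y n ∣)

0ℝ : ℝ
0ℝ = mkℝ (λ _ → 0ℚ) λ ε ε>0 → 0 , λ _ _ _ _ → ε>0

private
  interchange : ∀ a b c d → (a ℚ.+ b) ℚ.- (c ℚ.+ d) ≡ (a ℚ.- c) ℚ.+ (b ℚ.- d)
  interchange a b c d = begin
    (a ℚ.+ b) ℚ.- (c ℚ.+ d)            ≡⟨ cong ((a ℚ.+ b) ℚ.+_) (ℚₚ.neg-distrib-+ c d) ⟩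
    (a ℚ.+ b) ℚ.+ (ℚ.- c ℚ.+ ℚ.- d)    ≡⟨ ℚₚ.+-assoc a b _ ⟩
    a ℚ.+ (b ℚ.+ (ℚ.- c ℚ.+ ℚ.- d))    ≡⟨ cong (a ℚ.+_) (sym (ℚₚ.+-assoc b (ℚ.- c) (ℚ.- d))) ⟩
    a ℚ.+ ((b ℚ.+ ℚ.- c) ℚ.+ ℚ.- d)    ≡⟨ cong (λ t → a ℚ.+ (t ℚ.+ ℚ.- d)) (ℚₚ.+-comm b (ℚ.- c)) ⟩
    a ℚ.+ ((ℚ.- c ℚ.+ b) ℚ.+ ℚ.- d)    ≡⟨ cong (a ℚ.+_) (ℚₚ.+-assoc (ℚ.- c) b (ℚ.- d)) ⟩
    a ℚ.+ (ℚ.- c ℚ.+ (b ℚ.- d))        ≡⟨ sym (ℚₚ.+-assoc a (ℚ.- c) (b ℚ.- d)) ⟩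
    (a ℚ.- c) ℚ.+ (b ℚ.- d)            ∎
    where open ≡-Reasoning

  half-pos : ∀ ε → 0ℚ ℚ.< ε → 0ℚ ℚ.< ½ ℚ.* ε
  half-pos ε ε>0 = subst (ℚ._< ½ ℚ.* ε) (ℚₚ.*-zeroʳ ½) (ℚₚ.*-monoʳ-<-pos ½ ε>0)

  half+half : ∀ ε → ½ ℚ.* ε ℚ.+ ½ ℚ.* ε ≡ ε
  half+half ε = trans (sym (ℚₚ.*-distribʳ-+ ε ½ ½)) (ℚₚ.*-identityˡ ε)

_+ℝ_ : ℝ → ℝ → ℝ
x +ℝ y = mkℝ (λ n → seq x n ℚ.+ seq y n) +-cauchy
  where
  +-cauchy : ∀ ε → 0ℚ ℚ.< ε → ∃[ N ] ∀ m n → N ≤ m → N ≤ n →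
             ℚ.∣ (seq x m ℚ.+ seq y m) ℚ.- (seq x n ℚ.+ seq y n) ∣ ℚ.< ε
  +-cauchy ε ε>0 with cauchy x (½ ℚ.* ε) (half-pos ε ε>0) | cauchy y (½ ℚ.* ε) (half-pos ε ε>0)
  ... | M , p | N , q = M ⊔ N , λ m n m≥ n≥ → begin-strict
      ℚ.∣ (seq x m ℚ.+ seq y m) ℚ.- (seq x n ℚ.+ seq y n) ∣
    ≡⟨ cong ℚ.∣_∣ (interchange (seq x m) (seq y m) (seq x n) (seq y n)) ⟩
      ℚ.∣ (seq x m ℚ.- seq x n) ℚ.+ (seq y m ℚ.- seq y n) ∣
    ≤⟨ ℚₚ.∣p+q∣≤∣p∣+∣q∣ (seq x m ℚ.- seq x n) (seq y m ℚ.- seq y n) ⟩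
      ℚ.∣ seq x m ℚ.- seq x n ∣ ℚ.+ ℚ.∣ seq y m ℚ.- seq y n ∣
    <⟨ ℚₚ.+-mono-< (p m n (ℕₚ.m⊔n≤o⇒m≤o M N m≥) (ℕₚ.m⊔n≤o⇒m≤o M N n≥))
                   (q m n (ℕₚ.m⊔n≤o⇒n≤o M N m≥) (ℕₚ.m⊔n≤o⇒n≤o M N n≥)) ⟩
      ½ ℚ.* ε ℚ.+ ½ ℚ.* ε
    ≡⟨ half+half ε ⟩
      ε
    ∎
    where open ℚₚ.≤-Reasoning

sumℝ : List ℝ → ℝ
sumℝ = foldr _+ℝ_ 0ℝ

record RealSet (k : ℕ) : Set where
  field
    element  : Fin k → ℝ
    distinct : ∀ i j → i ≢ j → element i # element j

open RealSet public

infix 4 _∈ℝ_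

_∈ℝ_ : ∀ {k} → ℝ → RealSet k → Set
x ∈ℝ S = ∃[ i ] x ≃ element S i

-- The pair ends e represents the unordered pair of endpoints of e.
record Graph : Set₁ where
  field
    V E      : Set
    ∣V∣ ∣E∣  : ℕ
    enumV    : V ↔ Fin ∣V∣
    enumE    : E ↔ Fin ∣E∣
    ends     : E → V × V
    loopless : ∀ e → proj₁ (ends e) ≢ proj₂ (ends e)
    simple   : ∀ e e′ → ends e ≡ ends e′ ⊎ ends e ≡ swap (ends e′) → e ≡ e′

  edge : Fin ∣E∣ → E
  edge = Inverse.from enumE

  edges : List E
  edges = map edge (allFin ∣E∣)

  infix 4 _≟V_ _≟E_

  _≟V_ : DecidableEquality V
  _≟V_ = Finₚ.inj⇒≟ (↔⇒↣ enumV)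

  _≟E_ : DecidableEquality E
  _≟E_ = Finₚ.inj⇒≟ (↔⇒↣ enumE)

  _≟VE_ : DecidableEquality (V ⊎ E)
  _≟VE_ = Sumₚ.≡-dec _≟V_ _≟E_

  Incident : V → E → Set
  Incident v e = v ≡ proj₁ (ends e) ⊎ v ≡ proj₂ (ends e)

  incident? : ∀ v e → Dec (Incident v e)
  incident? v e = (v ≟V proj₁ (ends e)) ⊎-dec (v ≟V proj₂ (ends e))

record Orientation (G : Graph) : Set where
  open Graph G
  field
    tail head : E → V
    oriented  : ∀ e → ends e ≡ (tail e , head e) ⊎ ends e ≡ (head e , tail e)

Matrix : ℕ → Set → Set
Matrix r C = Fin r → C → ℤ

-- The permutations of Fin n, each listed once, by the image i of zero.
permutations : ∀ n → List (Permutation′ n)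
permutations zero    = idₚ ∷ []
permutations (suc n) =
  concatMap (λ i → map (insert zero i) (permutations n)) (allFin (suc n))

permutations-complete : ∀ n (π : Permutation′ n) → Any (_≈ₚ π) (permutations n)
permutations-complete zero    π = here λ ()
permutations-complete (suc n) π =
  Anyₚ.concatMap⁺ _ (Any.map inRow (∈-allFin (π ⟨$⟩ʳ zero)))
  where
  inRow : ∀ {i} → π ⟨$⟩ʳ zero ≡ i →
          Any (_≈ₚ π) (map (insert zero i) (permutations n))
  inRow refl = Anyₚ.map⁺ (Any.map
    (λ {σ} σ≈ k → trans (insert-cong σ≈ k) (insert-remove zero π k))
    (permutations-complete n (remove zero π)))
    where
    insert-cong : ∀ {i} {σ τ : Permutation′ n} → σ ≈ₚ τ → insert zero i σ ≈ₚ insert zero i τ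
    insert-cong         σ≈τ zero    = refl
    insert-cong {i = i} σ≈τ (suc k) = cong (punchIn i) (σ≈τ k)

length-permutations : ∀ n → length (permutations n) ≡ n !
length-permutations zero    = refl
length-permutations (suc n) = trans (lemma (allFin (suc n)))
  (cong₂ ℕ._*_ (length-tabulate {n = suc n} (λ i → i)) (length-permutations n))
  where
  lemma : ∀ is → length (concatMap (λ i → map (insert zero i) (permutations n)) is)
                 ≡ length is ℕ.* length (permutations n)
  lemma []       = refl
  lemma (i ∷ is) = trans (length-++ (map (insert zero i) (permutations n)))
    (cong₂ ℕ._+_ (length-map (insert zero i) (permutations n)) (lemma is))

per : ∀ {r} → Matrix r (Fin r) → ℤ
per {r} A = foldr ℤ._+_ 0ℤ (map term (permutations r))
  where
  term : Permutation′ r → ℤ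
  term σ = foldr ℤ._*_ 1ℤ (map (λ i → A i (σ ⟨$⟩ʳ i)) (allFin r))

module _ {r : ℕ} {C : Set} (_≟_ : DecidableEquality C) where

  occurrences : C → (Fin r → C) → ℕ
  occurrences z c = length (filter (λ i → c i ≟ z) (allFin r))

  -- The square matrix A′ is given by c: its i-th column is column c i of A.
  NonzeroPer : Matrix r C → ℕ → Set
  NonzeroPer A k = ∃[ c ] per (λ i j → A i (c j)) ≢ 0ℤ × (∀ z → occurrences z c ≤ k)

  -- pind A = k, for finite k.
  PermanentIndex : Matrix r C → ℕ → Set
  PermanentIndex A k =
    1 ≤ k × NonzeroPer A k × (∀ k′ → 1 ≤ k′ → NonzeroPer A k′ → k ≤ k′)

module _ (G : Graph) where
  open Graph G

  matrixA : Orientation G → Matrix ∣E∣ (V ⊎ E)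
  matrixA o i = row (edge i)
    where
    open Orientation o
    row : E → V ⊎ E → ℤ
    row e (inj₁ v)  = if does (v ≟V head e) then 1ℤ
                      else if does (v ≟V tail e) then -1ℤ
                      else 0ℤ
    row e (inj₂ e′) = if does (e′ ≟E e) then 0ℤ
                      else if does (incident? (head e) e′) then 1ℤ
                      else if does (incident? (tail e) e′) then -1ℤ
                      else 0ℤ

  -- Pind k: pind (A_G) = k, for every orientation used to define A_G.
  Pind : ℕ → Set
  Pind k = ∀ (o : Orientation G) → PermanentIndex _≟VE_ (matrixA o) k

  vertexSum : (V ⊎ E → ℝ) → V → ℝ
  vertexSum f v = f (inj₁ v) +ℝ sumℝ (map (f ∘ inj₂) (filter (incident? v) edges))

  Proper : (V ⊎ E → ℝ) → Set
  Proper f = ∀ e → vertexSum f (proj₁ (ends e)) # vertexSum f (proj₂ (ends e))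

  Choosable : ℕ → ℕ → Set
  Choosable k k′ =
    (L : V → RealSet k) (L′ : E → RealSet k′) →
    ∃[ f ] Proper f × (∀ v → f (inj₁ v) ∈ℝ L v) × (∀ e → f (inj₂ e) ∈ℝ L′ e)

-- Vertices are numbered from 0.
GridV : ℕ → ℕ → Set
GridV n m = Fin n × Fin m

Step : ∀ {n m} → GridV n m → GridV n m → Set
Step (i , j) (i′ , j′) =
  (i ≡ i′ × toℕ j′ ≡ suc (toℕ j)) ⊎ (toℕ i′ ≡ suc (toℕ i) × j ≡ j′)

GridE : ℕ → ℕ → Set
GridE n m = Σ (GridV n m × GridV n m) λ (u , v) → Step u v

Consecutive : ℕ → Set
Consecutive n = Σ (Fin n × Fin n) λ (i , i′) → toℕ i′ ≡ suc (toℕ i)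

enumConsecutive : ∀ n → Consecutive n ↔ Fin (pred n)
enumConsecutive zero    = mk↔ₛ′ (λ { ((() , _) , _) }) (λ ()) (λ ()) (λ { ((() , _) , _) })
enumConsecutive (suc n) = mk↔ₛ′ to from (λ _ → refl) from∘to
  where
  to : Consecutive (suc n) → Fin n
  to ((i , suc k) , _) = k

  from : Fin n → Consecutive (suc n)
  from k = (inject₁ k , suc k) , cong suc (sym (Finₚ.toℕ-inject₁ k))

  from∘to : ∀ c → from (to c) ≡ c
  from∘to ((i , suc k) , p)
    with refl ← Finₚ.toℕ-injective (trans (Finₚ.toℕ-inject₁ k) (ℕₚ.suc-injective p))
    = cong (_ ,_) (ℕₚ.≡-irrelevant _ p)

splitGridE : ∀ n m → GridE n m ↔ ((Fin n × Consecutive m) ⊎ (Consecutive n × Fin m))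
splitGridE n m = mk↔ₛ′ to from to∘from from∘to
  where
  to : GridE n m → (Fin n × Consecutive m) ⊎ (Consecutive n × Fin m)
  to (((i , j) , (i′ , j′)) , inj₁ (_ , p)) = inj₁ (i , (j , j′) , p)
  to (((i , j) , (i′ , j′)) , inj₂ (p , _)) = inj₂ (((i , i′) , p) , j)

  from : (Fin n × Consecutive m) ⊎ (Consecutive n × Fin m) → GridE n m
  from (inj₁ (i , (j , j′) , p))   = ((i , j) , (i , j′)) , inj₁ (refl , p)
  from (inj₂ (((i , i′) , p) , j)) = ((i , j) , (i′ , j)) , inj₂ (p , refl)

  to∘from : ∀ x → to (from x) ≡ x
  to∘from (inj₁ _) = refl
  to∘from (inj₂ _) = refl

  from∘to : ∀ e → from (to e) ≡ e
  from∘to (_ , inj₁ (refl , _)) = refl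
  from∘to (_ , inj₂ (_ , refl)) = refl

enumGridE : ∀ n m → GridE n m ↔ Fin (n ℕ.* pred m ℕ.+ pred n ℕ.* m)
enumGridE n m = ↔-trans (splitGridE n m) (↔-trans
  ((↔-refl ×-cong enumConsecutive m) ⊎-cong (enumConsecutive n ×-cong ↔-refl))
  (↔-trans (↔-sym Finₚ.*↔× ⊎-cong ↔-sym Finₚ.*↔×) (↔-sym Finₚ.+↔⊎)))

-- Edges of P_n □ P_m: each unordered adjacent pair is given once, by the
-- ordering in which the coordinates increase.
grid : ℕ → ℕ → Graph
grid n m = record
  { V        = GridV n m
  ; E        = GridE n m
  ; ∣V∣      = n ℕ.* m
  ; ∣E∣      = n ℕ.* pred m ℕ.+ pred n ℕ.* m
  ; enumV    = ↔-sym Finₚ.*↔×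
  ; enumE    = enumGridE n m
  ; ends     = proj₁
  ; loopless = λ { (_ , s) refl → step-irrefl s }
  ; simple   = λ
    { (_ , s) (_ , s′) (inj₁ refl) → cong (_ ,_) (step-irrelevant s s′)
    ; (_ , s) (_ , s′) (inj₂ refl) → contradiction s′ (step-asym s)
    }
  }
  where
  step-irrefl : ∀ {u : GridV n m} → ¬ Step u u
  step-irrefl (inj₁ (_ , p)) = ℕₚ.1+n≢n (sym p)
  step-irrefl (inj₂ (p , _)) = ℕₚ.1+n≢n (sym p)

  no-2-cycle : ∀ {a b} → a ≡ suc b → b ≢ suc a
  no-2-cycle {b = b} refl p = ℕₚ.m≢1+n+m b {1} p

  step-asym : ∀ {u v : GridV n m} → Step u v → ¬ Step v u
  step-asym (inj₁ (_ , p))    (inj₁ (_ , q))    = no-2-cycle p q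
  step-asym (inj₁ (refl , _)) (inj₂ (q , _))    = ℕₚ.1+n≢n (sym q)
  step-asym (inj₂ (p , _))    (inj₁ (refl , _)) = ℕₚ.1+n≢n (sym p)
  step-asym (inj₂ (p , _))    (inj₂ (q , _))    = no-2-cycle p q

  Fin-irrelevant : ∀ {k} {i j : Fin k} (p q : i ≡ j) → p ≡ q
  Fin-irrelevant = Decidable⇒UIP.≡-irrelevant Finₚ._≟_

  step-irrelevant : ∀ {u v : GridV n m} (s t : Step u v) → s ≡ t
  step-irrelevant (inj₁ (p , q)) (inj₁ (p′ , q′)) =
    cong inj₁ (cong₂ _,_ (Fin-irrelevant p p′) (ℕₚ.≡-irrelevant q q′))
  step-irrelevant (inj₁ (refl , _)) (inj₂ (p , _)) = contradiction (sym p) ℕₚ.1+n≢n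
  step-irrelevant (inj₂ (p , _)) (inj₁ (refl , _)) = contradiction (sym p) ℕₚ.1+n≢n
  step-irrelevant (inj₂ (p , q)) (inj₂ (p′ , q′)) =
    cong inj₂ (cong₂ _,_ (ℕₚ.≡-irrelevant p p′) (Fin-irrelevant q q′))

{-# OPTIONS --safe #-}

module Submission where

open import Defs
open import Data.Bool using (Bool; true; false; not; if_then_else_)
open import Data.Fin using (Fin; zero; suc; toℕ; punchIn; inject₁; fromℕ; opposite)
open import Data.Fin.Induction using (<-weakInduction)
open import Data.Fin.Permutation using (Permutation′; _⟨$⟩ʳ_; insert)
import Data.Fin.Properties as Finₚ
open import Data.Integer as ℤ using (ℤ; 0ℤ; 1ℤ; -1ℤ)
import Data.Integer.Properties as ℤₚ
import Data.Integer.Tactic.RingSolver as ℤSolver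
open import Data.List
  using (List; []; _∷_; _++_; map; foldr; filter; length; lookup; allFin; concatMap; tabulate)
import Data.List.Membership.DecPropositional as DecMembership
open import Data.List.Membership.Propositional using (_∈_; _∉_)
open import Data.List.Membership.Propositional.Properties
  using (∈-allFin; ∈-lookup; ∈-map⁺; ∈-filter⁺; ∈-filter⁻)
open import Data.List.Membership.Propositional.Properties.WithK using (unique∧set⇒bag)
import Data.List.Properties as Listₚ
open import Data.List.Relation.Binary.BagAndSetEquality using (∼bag⇒↭)
open import Data.List.Relation.Binary.Permutation.Propositional using (_↭_; refl; prep; swap; trans)
open import Data.List.Relation.Unary.All as All using (All; []; _∷_)
import Data.List.Relation.Unary.All.Properties as Allₚ
open import Data.List.Relation.Unary.AllPairs using ([]; _∷_)
open import Data.List.Relation.Unary.Any using (here; there)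
open import Data.List.Relation.Unary.Unique.Propositional using (Unique)
open import Data.List.Relation.Unary.Unique.Propositional.Properties
  using (allFin⁺; filter⁺; map⁺; Unique[x∷xs]⇒x∉xs)
open import Data.Nat using (ℕ; zero; suc; z≤n; s≤s)
import Data.Nat as ℕ
import Data.Nat.Properties as ℕₚ
import Data.Nat.Tactic.RingSolver as ℕSolver
open import Data.Product as Product using (Σ; ∃; ∃-syntax; _×_; _,_; proj₁; proj₂)
open import Data.Rational as ℚ using (ℚ; 0ℚ; 1ℚ; ½)
import Data.Rational.Properties as ℚₚ
open import Data.Rational.Unnormalised as ℚᵘ using (mkℚᵘ; *≡*)
import Data.Rational.Unnormalised.Properties as ℚᵘₚ
open import Data.Sum as Sum using (_⊎_; inj₁; inj₂)
open import Data.Sum.Properties using (inj₁-injective; inj₂-injective)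
open import Data.Unit using (⊤; tt)
open import Data.Vec using (Vec; []; _∷_)
open import Function.Base using (_∘_; id)
open import Function.Bundles using (Inverse; mk⇔)
open import Level using (0ℓ)
open import Relation.Binary.PropositionalEquality as ≡
  using (_≡_; _≢_; refl; sym; cong; cong₂; subst; module ≡-Reasoning)
open import Relation.Nullary using (¬_; Dec; yes; no; does; contradiction)
open import Relation.Nullary.Decidable using (dec⇒maybe)
open import Tactic.RingSolver using (solve-∀)
open import Tactic.RingSolver.Core.AlmostCommutativeRing
  using (AlmostCommutativeRing; fromCommutativeRing)

-- Lay a snake through the grid, row by row in alternating directions, and add
-- the vertices in this order. The permanent is kept nonzero with w, the last
-- vertex added, as an extra column. A new vertex v meets the old graph in the
-- edge f = vw and possibly one edge g = vu; the columns of the matrix satisfy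
-- col f = col v + col w, and col v vanishes on the old rows, so replacing the
-- extra w by f and adding v once or twice multiplies the permanent by ±1 or ±2.
-- All columns stay distinct except for the extra copy, and the first vertex of a
-- row is not a column itself. At the end of the snake u is such a vertex, and
-- col v = col g - col u exchanges the extra copy for an unused column.
--
-- Choosability is the combinatorial Nullstellensatz: the alternating sum, over all
-- choices for the selected columns, of the product of the differences φ(u) - φ(v) is
-- the permanent times the product of the gaps in the lists. Reals being Cauchy
-- sequences, this is used with explicit bounds at a sufficiently late index.

-- Permanents

module _ where
  open import Data.Integer using (_+_; _*_)
  open ≡-Reasoning

  -- The common shape of Laplace expansions: `φ` receives an entry and the list with that entry
  -- deleted, so minors are handled without reindexing.
  sumPicks : {X : Set} → (X → List X → ℤ) → List X → ℤ
  sumPicks φ []       = 0ℤ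
  sumPicks φ (x ∷ xs) = φ x xs + sumPicks (λ y ys → φ y (x ∷ ys)) xs

  module _ {X : Set} where

    sumPicks-cong : ∀ {φ ψ : X → List X → ℤ} → (∀ x ys → φ x ys ≡ ψ x ys) →
                    ∀ xs → sumPicks φ xs ≡ sumPicks ψ xs
    sumPicks-cong φ≡ψ []       = refl
    sumPicks-cong φ≡ψ (x ∷ xs) =
      cong₂ _+_ (φ≡ψ x xs) (sumPicks-cong (λ y ys → φ≡ψ y (x ∷ ys)) xs)

    sumPicks-zero : ∀ {φ : X → List X → ℤ} {xs} → All (λ x → ∀ ys → φ x ys ≡ 0ℤ) xs →
                    sumPicks φ xs ≡ 0ℤ
    sumPicks-zero []           = refl
    sumPicks-zero {xs = x ∷ xs} (p ∷ ps) =
      cong₂ _+_ (p xs) (sumPicks-zero (All.map (λ q ys → q (x ∷ ys)) ps))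

    sumPicks-+ : ∀ (φ ψ : X → List X → ℤ) xs →
                 sumPicks (λ x ys → φ x ys + ψ x ys) xs ≡ sumPicks φ xs + sumPicks ψ xs
    sumPicks-+ φ ψ []       = refl
    sumPicks-+ φ ψ (x ∷ xs) = ≡.trans
      (cong (φ x xs + ψ x xs +_) (sumPicks-+ (λ y ys → φ y (x ∷ ys)) (λ y ys → ψ y (x ∷ ys)) xs))
      (interchange (φ x xs) (ψ x xs) _ _)
      where
      interchange : ∀ a b c d → (a + b) + (c + d) ≡ (a + c) + (b + d)
      interchange = ℤSolver.solve-∀

    *-sumPicks : ∀ k (φ : X → List X → ℤ) xs →
                 k * sumPicks φ xs ≡ sumPicks (λ x ys → k * φ x ys) xs
    *-sumPicks k φ []       = ℤₚ.*-zeroʳ k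
    *-sumPicks k φ (x ∷ xs) = ≡.trans (ℤₚ.*-distribˡ-+ k (φ x xs) _)
      (cong (k * φ x xs +_) (*-sumPicks k (λ y ys → φ y (x ∷ ys)) xs))

  sumPicks-swap : ∀ {X Y : Set} (φ : X → List X → Y → List Y → ℤ) xs ys →
    sumPicks (λ x xs′ → sumPicks (φ x xs′) ys) xs ≡
    sumPicks (λ y ys′ → sumPicks (λ x xs′ → φ x xs′ y ys′) xs) ys
  sumPicks-swap φ []       ys = sym (sumPicks-zero (All.universal (λ _ _ → refl) ys))
  sumPicks-swap φ (x ∷ xs) ys = ≡.trans
    (cong (sumPicks (φ x xs) ys +_) (sumPicks-swap (λ x′ xs′ → φ x′ (x ∷ xs′)) xs ys))
    (sym (sumPicks-+ (φ x xs) _ ys))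

  module Permanent {R C : Set} (a : R → C → ℤ) where

    permanent : List R → List C → ℤ
    permanent []       []       = 1ℤ
    permanent []       (_ ∷ _)  = 0ℤ
    permanent (r ∷ rs) cs       = sumPicks (λ c cs′ → a r c * permanent rs cs′) cs

    -- Induction on the rows. If the first row picks `c`, this is the first summand; otherwise
    -- expand the remaining minors along `c` and exchange the two sums.
    columnExpansion : ∀ rs c cs →
      permanent rs (c ∷ cs) ≡ sumPicks (λ r rs′ → a r c * permanent rs′ cs) rs
    columnExpansion []       c cs = refl
    columnExpansion (r ∷ rs) c cs = cong (a r c * permanent rs cs +_) (begin
        sumPicks (λ c′ cs′ → a r c′ * permanent rs (c ∷ cs′)) cs
      ≡⟨ sumPicks-cong (λ c′ cs′ → ≡.trans
           (cong (a r c′ *_) (columnExpansion rs c cs′))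
           (*-sumPicks (a r c′) _ rs)) cs ⟩
        sumPicks (λ c′ cs′ → sumPicks (λ r′ rs′ → a r c′ * (a r′ c * permanent rs′ cs′)) rs) cs
      ≡⟨ sumPicks-swap _ cs rs ⟩
        sumPicks (λ r′ rs′ → sumPicks (λ c′ cs′ → a r c′ * (a r′ c * permanent rs′ cs′)) cs) rs
      ≡⟨ sumPicks-cong (λ r′ rs′ → ≡.trans
           (sumPicks-cong (λ c′ cs′ → exchange (a r c′) (a r′ c) (permanent rs′ cs′)) cs)
           (sym (*-sumPicks (a r′ c) _ cs))) rs ⟩
        sumPicks (λ r′ rs′ → a r′ c * permanent (r ∷ rs′) cs) rs
      ∎)
      where
      exchange : ∀ x y z → x * (y * z) ≡ y * (x * z)
      exchange = ℤSolver.solve-∀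

    permanent-length : ∀ rs cs → permanent rs cs ≢ 0ℤ → length cs ≡ length rs
    permanent-length rs cs p≢0 with length cs ℕ.≟ length rs
    ... | yes eq = eq
    ... | no  ne = contradiction (vanish rs cs ne) p≢0
      where
      vanish : ∀ rs cs → length cs ≢ length rs → permanent rs cs ≡ 0ℤ
      -- The map `g` puts back the `k` columns that the sum has already passed over.
      vanishPicks : ∀ r rs cs k (g : List C → List C) →
        (∀ ds → length (g ds) ≡ k ℕ.+ length ds) → k ℕ.+ length cs ≢ suc (length rs) →
        sumPicks (λ c cs′ → a r c * permanent rs (g cs′)) cs ≡ 0ℤ
      vanish []       []       ne = contradiction refl ne
      vanish []       (_ ∷ _)  ne = refl
      vanish (r ∷ rs) cs       ne = vanishPicks r rs cs 0 id (λ _ → refl) ne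
      vanishPicks r rs []       k g eq ne = refl
      vanishPicks r rs (c ∷ cs) k g eq ne = cong₂ _+_
        (≡.trans (cong (a r c *_) (vanish rs (g cs) λ e → ne
          (≡.trans (ℕₚ.+-suc k _) (cong suc (≡.trans (sym (eq cs)) e))))) (ℤₚ.*-zeroʳ (a r c)))
        (vanishPicks r rs cs (suc k) (g ∘ (c ∷_))
          (λ ds → ≡.trans (eq (c ∷ ds)) (ℕₚ.+-suc k _))
          (ne ∘ ≡.trans (ℕₚ.+-suc k _)))

    -- The definition expands along rows and hides the symmetry in them. Expanding along the first
    -- column shows it: two summands change places, and the others agree by induction.
    permanent-swap : ∀ r r′ rs cs → permanent (r ∷ r′ ∷ rs) cs ≡ permanent (r′ ∷ r ∷ rs) cs
    permanent-swap r r′ rs []       = refl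
    permanent-swap r r′ rs (c ∷ cs) = begin
        permanent (r ∷ r′ ∷ rs) (c ∷ cs)
      ≡⟨ columnExpansion (r ∷ r′ ∷ rs) c cs ⟩
        a r c * permanent (r′ ∷ rs) cs + (a r′ c * permanent (r ∷ rs) cs +
          sumPicks (λ s rs′ → a s c * permanent (r ∷ r′ ∷ rs′) cs) rs)
      ≡⟨ exchange (a r c * permanent (r′ ∷ rs) cs) (a r′ c * permanent (r ∷ rs) cs) _ ⟩
        a r′ c * permanent (r ∷ rs) cs + (a r c * permanent (r′ ∷ rs) cs +
          sumPicks (λ s rs′ → a s c * permanent (r ∷ r′ ∷ rs′) cs) rs)
      ≡⟨ cong (λ t → a r′ c * permanent (r ∷ rs) cs + (a r c * permanent (r′ ∷ rs) cs + t))
           (sumPicks-cong (λ s rs′ → cong (a s c *_) (permanent-swap r r′ rs′ cs)) rs) ⟩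
        a r′ c * permanent (r ∷ rs) cs + (a r c * permanent (r′ ∷ rs) cs +
          sumPicks (λ s rs′ → a s c * permanent (r′ ∷ r ∷ rs′) cs) rs)
      ≡⟨ columnExpansion (r′ ∷ r ∷ rs) c cs ⟨
        permanent (r′ ∷ r ∷ rs) (c ∷ cs)
      ∎
      where
      exchange : ∀ x y z → x + (y + z) ≡ y + (x + z)
      exchange = ℤSolver.solve-∀

    permanent-↭ : ∀ {rs rs′} → rs ↭ rs′ → ∀ cs → permanent rs cs ≡ permanent rs′ cs
    permanent-↭ refl                   cs = refl
    permanent-↭ (prep r rs↭rs′)        cs =
      sumPicks-cong (λ c cs′ → cong (a r c *_) (permanent-↭ rs↭rs′ cs′)) cs
    permanent-↭ (swap {xs = rs} r r′ rs↭rs′) cs = ≡.trans (permanent-swap r r′ rs cs)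
      (sumPicks-cong (λ c cs′ → cong (a r′ c *_)
        (sumPicks-cong (λ d ds → cong (a r d *_) (permanent-↭ rs↭rs′ ds)) cs′)) cs)
    permanent-↭ (trans p q)            cs = ≡.trans (permanent-↭ p cs) (permanent-↭ q cs)

    permanent-column-cong : ∀ {c c′ rs} → All (λ r → a r c ≡ a r c′) rs → ∀ cs →
      permanent rs (c ∷ cs) ≡ permanent rs (c′ ∷ cs)
    permanent-column-cong {c} {c′} {rs} eqs cs = ≡.trans (columnExpansion rs c cs)
      (≡.trans (go eqs _) (sym (columnExpansion rs c′ cs)))
      where
      go : ∀ {rs} → All (λ r → a r c ≡ a r c′) rs → (g : List R → ℤ) →
        sumPicks (λ r rs′ → a r c * g rs′) rs ≡ sumPicks (λ r rs′ → a r c′ * g rs′) rs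
      go []             g = refl
      go {r ∷ rs} (eq ∷ eqs) g = cong₂ _+_ (cong (_* g rs) eq) (go eqs (g ∘ (r ∷_)))

    permanent-column-+ : ∀ c d e → (∀ r → a r c ≡ a r d + a r e) → ∀ rs cs →
      permanent rs (c ∷ cs) ≡ permanent rs (d ∷ cs) + permanent rs (e ∷ cs)
    permanent-column-+ c d e eq rs cs = begin
        permanent rs (c ∷ cs)
      ≡⟨ columnExpansion rs c cs ⟩
        sumPicks (λ r rs′ → a r c * permanent rs′ cs) rs
      ≡⟨ sumPicks-cong (λ r rs′ → ≡.trans (cong (_* permanent rs′ cs) (eq r))
           (ℤₚ.*-distribʳ-+ (permanent rs′ cs) (a r d) (a r e))) rs ⟩
        sumPicks (λ r rs′ → a r d * permanent rs′ cs + a r e * permanent rs′ cs) rs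
      ≡⟨ sumPicks-+ _ _ rs ⟩
        sumPicks (λ r rs′ → a r d * permanent rs′ cs) rs + sumPicks (λ r rs′ → a r e * permanent rs′ cs) rs
      ≡⟨ cong₂ _+_ (columnExpansion rs d cs) (columnExpansion rs e cs) ⟨
        permanent rs (d ∷ cs) + permanent rs (e ∷ cs)
      ∎

    private
      below : ∀ {c rs} → All (λ r → a r c ≡ 0ℤ) rs → (g : List R → ℤ) →
              sumPicks (λ r rs′ → a r c * g rs′) rs ≡ 0ℤ
      below zs g = sumPicks-zero (All.map (λ z rs′ → cong (_* g rs′) z) zs)

    permanent-single : ∀ r c {rs} → All (λ s → a s c ≡ 0ℤ) rs → ∀ cs →
      permanent (r ∷ rs) (c ∷ cs) ≡ a r c * permanent rs cs
    permanent-single r c {rs} zs cs = ≡.trans (columnExpansion (r ∷ rs) c cs)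
      (≡.trans (cong (a r c * permanent rs cs +_) (below zs _)) (ℤₚ.+-identityʳ _))

    -- The two copies of `c` can only be matched with `r` and `r′`, and there are two ways to do so.
    permanent-double : ∀ r r′ c {rs} → All (λ s → a s c ≡ 0ℤ) rs → ∀ cs →
      permanent (r ∷ r′ ∷ rs) (c ∷ c ∷ cs) ≡ ℤ.+ 2 * (a r c * (a r′ c * permanent rs cs))
    permanent-double r r′ c {rs} zs cs = begin
        permanent (r ∷ r′ ∷ rs) (c ∷ c ∷ cs)
      ≡⟨ columnExpansion (r ∷ r′ ∷ rs) c (c ∷ cs) ⟩
        a r c * permanent (r′ ∷ rs) (c ∷ cs) + (a r′ c * permanent (r ∷ rs) (c ∷ cs) +
          sumPicks (λ s rs′ → a s c * permanent (r ∷ r′ ∷ rs′) (c ∷ cs)) rs)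
      ≡⟨ cong₂ (λ x y → a r c * x + (a r′ c * y +
          sumPicks (λ s rs′ → a s c * permanent (r ∷ r′ ∷ rs′) (c ∷ cs)) rs))
          (permanent-single r′ c zs cs) (permanent-single r c zs cs) ⟩
        a r c * (a r′ c * permanent rs cs) + (a r′ c * (a r c * permanent rs cs) +
          sumPicks (λ s rs′ → a s c * permanent (r ∷ r′ ∷ rs′) (c ∷ cs)) rs)
      ≡⟨ cong (λ t → a r c * (a r′ c * permanent rs cs) + (a r′ c * (a r c * permanent rs cs) + t))
           (below zs _) ⟩
        a r c * (a r′ c * permanent rs cs) + (a r′ c * (a r c * permanent rs cs) + 0ℤ)
      ≡⟨ twice (a r c) (a r′ c) (permanent rs cs) ⟩
        ℤ.+ 2 * (a r c * (a r′ c * permanent rs cs))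
      ∎
      where
      twice : ∀ x y z → x * (y * z) + (y * (x * z) + 0ℤ) ≡ ℤ.+ 2 * (x * (y * z))
      twice = ℤSolver.solve-∀


  -- The sum over permutations as a permanent of lists

  sumFin : ∀ {k} → (Fin k → ℤ) → ℤ
  sumFin f = foldr _+_ 0ℤ (tabulate f)

  sumPicks-tabulate : ∀ {X : Set} k (φ : X → List X → ℤ) (γ : Fin (suc k) → X) →
    sumPicks φ (tabulate γ) ≡ sumFin λ i → φ (γ i) (tabulate (γ ∘ punchIn i))
  sumPicks-tabulate zero    φ γ = refl
  sumPicks-tabulate (suc k) φ γ = cong (φ (γ zero) (tabulate (γ ∘ suc)) +_)
    (sumPicks-tabulate k (λ y ys → φ y (γ zero ∷ ys)) (γ ∘ suc))

  -- The list `permutations` is grouped by the image `i` of `zero`, and `insert zero i σ` acts on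
  -- the other rows as `σ` followed by `punchIn i`. Each group is therefore one summand of the
  -- expansion.
  per-rowExpansion : ∀ {k} (M : Matrix (suc k) (Fin (suc k))) →
    per M ≡ sumFin λ i → M zero i * per (λ j l → M (suc j) (punchIn i l))
  per-rowExpansion {k} M = ≡.trans (rows (allFin (suc k)))
    (cong (foldr _+_ 0ℤ) (Listₚ.map-tabulate id λ i → M zero i * minor i (permutations k)))
    where
    term : Permutation′ (suc k) → ℤ
    term σ = foldr _*_ 1ℤ (map (λ j → M j (σ ⟨$⟩ʳ j)) (allFin (suc k)))
    subterm : Fin (suc k) → Permutation′ k → ℤ
    subterm i σ = foldr _*_ 1ℤ (map (λ j → M (suc j) (punchIn i (σ ⟨$⟩ʳ j))) (allFin k))
    minor : Fin (suc k) → List (Permutation′ k) → ℤ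
    minor i σs = foldr _+_ 0ℤ (map (subterm i) σs)
    term-insert : ∀ i σ → term (insert zero i σ) ≡ M zero i * subterm i σ
    term-insert i σ = cong (λ ts → M zero i * foldr _*_ 1ℤ ts) (≡.trans
      (Listₚ.map-tabulate {n = k} suc (λ j → M j (insert zero i σ ⟨$⟩ʳ j)))
      (sym (Listₚ.map-tabulate {n = k} id (λ j → M (suc j) (punchIn i (σ ⟨$⟩ʳ j))))))
    row : ∀ i σs τs → foldr _+_ 0ℤ (map term (map (insert zero i) σs ++ τs)) ≡
          M zero i * minor i σs + foldr _+_ 0ℤ (map term τs)
    row i []       τs = ≡.trans (sym (ℤₚ.+-identityˡ _)) (cong (_+ _) (sym (ℤₚ.*-zeroʳ (M zero i))))
    row i (σ ∷ σs) τs = ≡.trans (cong₂ _+_ (term-insert i σ) (row i σs τs))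
      (distrib (M zero i) (subterm i σ) (minor i σs) _)
      where
      distrib : ∀ x y z w → x * y + (x * z + w) ≡ x * (y + z) + w
      distrib = ℤSolver.solve-∀
    rows : ∀ is → foldr _+_ 0ℤ (map term (concatMap (λ i → map (insert zero i) (permutations k)) is)) ≡
           foldr _+_ 0ℤ (map (λ i → M zero i * minor i (permutations k)) is)
    rows []       = refl
    rows (i ∷ is) = ≡.trans (row i (permutations k) _)
      (cong (M zero i * minor i (permutations k) +_) (rows is))

  per-permanent : ∀ {R C : Set} (a : R → C → ℤ) {k} (ρ : Fin k → R) (γ : Fin k → C) →
    per (λ i j → a (ρ i) (γ j)) ≡ Permanent.permanent a (tabulate ρ) (tabulate γ)
  per-permanent a {zero}  ρ γ = refl
  per-permanent a {suc k} ρ γ = begin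
      per (λ i j → a (ρ i) (γ j))
    ≡⟨ per-rowExpansion (λ i j → a (ρ i) (γ j)) ⟩
      sumFin (λ i → a (ρ zero) (γ i) * per (λ j l → a (ρ (suc j)) (γ (punchIn i l))))
    ≡⟨ cong (foldr _+_ 0ℤ) (Listₚ.tabulate-cong λ i → cong (a (ρ zero) (γ i) *_)
         (per-permanent a (ρ ∘ suc) (γ ∘ punchIn i))) ⟩
      sumFin (λ i → a (ρ zero) (γ i) * permanent (tabulate (ρ ∘ suc)) (tabulate (γ ∘ punchIn i)))
    ≡⟨ sumPicks-tabulate k (λ c cs → a (ρ zero) c * permanent (tabulate (ρ ∘ suc)) cs) γ ⟨
      permanent (tabulate ρ) (tabulate γ)
    ∎
    where open Permanent a

-- Lists without repetitions

lookup-injective : ∀ {X : Set} {xs : List X} → Unique xs →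
                   ∀ {i j} → lookup xs i ≡ lookup xs j → i ≡ j
lookup-injective (x∉ ∷ u) {zero}  {zero}  eq = refl
lookup-injective (x∉ ∷ u) {zero}  {suc j} eq = contradiction eq (All.lookup x∉ (∈-lookup j))
lookup-injective (x∉ ∷ u) {suc i} {zero}  eq = contradiction (sym eq) (All.lookup x∉ (∈-lookup i))
lookup-injective (x∉ ∷ u) {suc i} {suc j} eq = cong suc (lookup-injective u eq)

unique⇒↭allFin : ∀ {k} {is : List (Fin k)} → Unique is → length is ≡ k → is ↭ allFin k
unique⇒↭allFin {k} {is} u len = ∼bag⇒↭ (unique∧set⇒bag u (allFin⁺ k)
  (λ {i} → mk⇔ (λ _ → ∈-allFin i) (λ _ → complete i)))
  where
  open DecMembership (Finₚ._≟_ {k}) using (_∈?_)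
  complete : ∀ i → i ∈ is
  complete i with i ∈? is
  ... | yes i∈is = i∈is
  -- Pigeonhole: adding the missing `i` would give `suc k` distinct elements of `Fin k`.
  ... | no  i∉is = contradiction
    (subst (ℕ._≤ k) (cong suc len)
      (Finₚ.injective⇒≤ (lookup-injective (Allₚ.¬Any⇒All¬ is i∉is ∷ u))))
    ℕₚ.1+n≰n

unique-constant⇒length≤1 : ∀ {X : Set} {xs : List X} → Unique xs →
  (∀ {x y} → x ∈ xs → y ∈ xs → x ≡ y) → length xs ℕ.≤ 1
unique-constant⇒length≤1 []                       const = z≤n
unique-constant⇒length≤1 (_ ∷ [])                 const = s≤s z≤n
unique-constant⇒length≤1 ((x≢y ∷ _) ∷ (_ ∷ _)) const =
  contradiction (const (here refl) (there (here refl))) x≢y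

tabulate-onto : ∀ {X : Set} {k} (xs : List X) → length xs ≡ k → ∃[ f ] tabulate {n = k} f ≡ xs
tabulate-onto xs refl = lookup xs , Listₚ.tabulate-lookup xs

tabulate-injective : ∀ {X : Set} {k} {f : Fin k → X} → Unique (tabulate f) →
                     ∀ {i j} → f i ≡ f j → i ≡ j
tabulate-injective (f₀∉ ∷ u) {zero}  {zero}  eq = refl
tabulate-injective (f₀∉ ∷ u) {zero}  {suc j} eq = contradiction eq (Allₚ.tabulate⁻ f₀∉ j)
tabulate-injective (f₀∉ ∷ u) {suc i} {zero}  eq = contradiction (sym eq) (Allₚ.tabulate⁻ f₀∉ i)
tabulate-injective (f₀∉ ∷ u) {suc i} {suc j} eq = cong suc (tabulate-injective u eq)

-- The matrix of a graph

indicator : ∀ {P : Set} → Dec P → ℤ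
indicator p? = if does p? then 1ℤ else 0ℤ

indicator-yes : ∀ {P : Set} (p? : Dec P) → P → indicator p? ≡ 1ℤ
indicator-yes (yes _) p = refl
indicator-yes (no ¬p) p = contradiction p ¬p

indicator-no : ∀ {P : Set} (p? : Dec P) → ¬ P → indicator p? ≡ 0ℤ
indicator-no (yes p) ¬p = contradiction p ¬p
indicator-no (no _)  ¬p = refl

module GraphMatrix (G : Graph) (o : Orientation G) where
  open Graph G
  open Orientation o

  A : Fin ∣E∣ → V ⊎ E → ℤ
  A = matrixA G o

  open Permanent A public

  -- The coefficient of the weight of `z` in the vertex sum of `v`.
  touch : V → V ⊎ E → ℤ
  touch v (inj₁ u) = indicator (u ≟V v)
  touch v (inj₂ e) = indicator (incident? v e)

  Joins : E → V → V → Set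
  Joins e u v = ends e ≡ (u , v) ⊎ ends e ≡ (v , u)

  joins-incident : ∀ {e u v x} → Joins e u v → Incident x e → x ≡ u ⊎ x ≡ v
  joins-incident (inj₁ eq) (inj₁ p) = inj₁ (≡.trans p (cong proj₁ eq))
  joins-incident (inj₁ eq) (inj₂ p) = inj₂ (≡.trans p (cong proj₂ eq))
  joins-incident (inj₂ eq) (inj₁ p) = inj₂ (≡.trans p (cong proj₁ eq))
  joins-incident (inj₂ eq) (inj₂ p) = inj₁ (≡.trans p (cong proj₂ eq))

  incident-left : ∀ {e u v} → Joins e u v → Incident u e
  incident-left (inj₁ eq) = inj₁ (sym (cong proj₁ eq))
  incident-left (inj₂ eq) = inj₂ (sym (cong proj₂ eq))

  joins-sym : ∀ {e u v} → Joins e u v → Joins e v u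
  joins-sym = Sum.swap

  joins-distinct : ∀ {e u v} → Joins e u v → u ≢ v
  joins-distinct {e} (inj₁ eq) u≡v =
    loopless e (≡.trans (cong proj₁ eq) (≡.trans u≡v (sym (cong proj₂ eq))))
  joins-distinct {e} (inj₂ eq) u≡v =
    loopless e (≡.trans (cong proj₁ eq) (≡.trans (sym u≡v) (sym (cong proj₂ eq))))

  joins-unique : ∀ {e e′ u v} → Joins e u v → Joins e′ u v → e ≡ e′
  joins-unique {e} {e′} (inj₁ p) (inj₁ q) = simple e e′ (inj₁ (≡.trans p (sym q)))
  joins-unique {e} {e′} (inj₁ p) (inj₂ q) = simple e e′ (inj₂ (≡.trans p (sym (cong Product.swap q))))
  joins-unique {e} {e′} (inj₂ p) (inj₁ q) = simple e e′ (inj₂ (≡.trans p (sym (cong Product.swap q))))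
  joins-unique {e} {e′} (inj₂ p) (inj₂ q) = simple e e′ (inj₁ (≡.trans p (sym q)))

  incident-joins : ∀ {e u v} → u ≢ v → Incident u e → Incident v e → Joins e u v
  incident-joins u≢v (inj₁ refl) (inj₁ q)    = contradiction (sym q) u≢v
  incident-joins u≢v (inj₁ refl) (inj₂ refl) = inj₁ refl
  incident-joins u≢v (inj₂ refl) (inj₁ refl) = inj₂ refl
  incident-joins u≢v (inj₂ refl) (inj₂ q)    = contradiction (sym q) u≢v

  head-tail : ∀ e → Joins e (head e) (tail e)
  head-tail e = Sum.swap (oriented e)

  -- A row of the matrix is the coefficient vector of the difference of the vertex sums at the two
  -- ends of an edge. The edge itself is counted at both ends and cancels; by simplicity no other
  -- edge meets both ends, so the order of the tests in `matrixA` is harmless.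
  A-touch : ∀ i z → A i z ≡ touch (head (edge i)) z ℤ.- touch (tail (edge i)) z
  A-touch i (inj₁ v) = lemma (v ≟V head (edge i)) (v ≟V tail (edge i))
    λ v≡h v≡t → joins-distinct (head-tail (edge i)) (≡.trans (sym v≡h) v≡t)
    where
    lemma : ∀ {P Q : Set} (p? : Dec P) (q? : Dec Q) → (P → ¬ Q) →
      (if does p? then 1ℤ else if does q? then -1ℤ else 0ℤ) ≡ indicator p? ℤ.- indicator q?
    lemma (yes p) (yes q) ¬pq = contradiction q (¬pq p)
    lemma (yes p) (no _)  ¬pq = refl
    lemma (no _)  (yes _) ¬pq = refl
    lemma (no _)  (no _)  ¬pq = refl
  A-touch i (inj₂ e) = lemma (e ≟E edge i) (incident? (head (edge i)) e) (incident? (tail (edge i)) e)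
    (λ { refl → incident-left (head-tail (edge i)) , incident-left (joins-sym (head-tail (edge i))) })
    (λ p q → joins-unique (incident-joins (joins-distinct (head-tail (edge i))) p q) (head-tail (edge i)))
    where
    lemma : ∀ {S P Q : Set} (s? : Dec S) (p? : Dec P) (q? : Dec Q) → (S → P × Q) → (P → Q → S) →
      (if does s? then 0ℤ else if does p? then 1ℤ else if does q? then -1ℤ else 0ℤ)
        ≡ indicator p? ℤ.- indicator q?
    lemma (yes s) (yes _) (yes _) to from = refl
    lemma (yes s) (no ¬p) q?      to from = contradiction (proj₁ (to s)) ¬p
    lemma (yes s) (yes _) (no ¬q) to from = contradiction (proj₂ (to s)) ¬q
    lemma (no ¬s) (yes p) (yes q) to from = contradiction (from p q) ¬s
    lemma (no _)  (yes _) (no _)  to from = refl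
    lemma (no _)  (no _)  (yes _) to from = refl
    lemma (no _)  (no _)  (no _)  to from = refl

  touch-edge : ∀ {e u v} → Joins e u v → ∀ x →
    touch x (inj₂ e) ≡ touch x (inj₁ u) ℤ.+ touch x (inj₁ v)
  touch-edge {e} {u} {v} j x = lemma (incident? x e) (u ≟V x) (v ≟V x)
    (Sum.map sym sym ∘ joins-incident j)
    (λ { refl → incident-left j }) (λ { refl → incident-left (joins-sym j) })
    (λ { refl v≡x → joins-distinct j (sym v≡x) })
    where
    lemma : ∀ {P Q R : Set} (p? : Dec P) (q? : Dec Q) (r? : Dec R) →
      (P → Q ⊎ R) → (Q → P) → (R → P) → (Q → ¬ R) →
      indicator p? ≡ indicator q? ℤ.+ indicator r?
    lemma p?      (yes q) (yes r) to f g ¬qr = contradiction r (¬qr q)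
    lemma p?      (yes q) (no _)  to f g ¬qr = indicator-yes p? (f q)
    lemma p?      (no _)  (yes r) to f g ¬qr = indicator-yes p? (g r)
    lemma p?      (no ¬q) (no ¬r) to f g ¬qr = indicator-no p? (Sum.[ ¬q , ¬r ] ∘ to)

  -- The linear relation behind every exchange of columns: the weight of an edge acts on all vertex
  -- sums like that weight placed on both of its ends.
  A-edge : ∀ {e u v} → Joins e u v → ∀ i → A i (inj₂ e) ≡ A i (inj₁ u) ℤ.+ A i (inj₁ v)
  A-edge {e} {u} {v} j i = begin
      A i (inj₂ e)
    ≡⟨ A-touch i (inj₂ e) ⟩
      touch h (inj₂ e) ℤ.- touch t (inj₂ e)
    ≡⟨ cong₂ ℤ._-_ (touch-edge j h) (touch-edge j t) ⟩
      (touch h (inj₁ u) ℤ.+ touch h (inj₁ v)) ℤ.- (touch t (inj₁ u) ℤ.+ touch t (inj₁ v))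
    ≡⟨ interchange (touch h (inj₁ u)) (touch h (inj₁ v)) (touch t (inj₁ u)) (touch t (inj₁ v)) ⟩
      (touch h (inj₁ u) ℤ.- touch t (inj₁ u)) ℤ.+ (touch h (inj₁ v) ℤ.- touch t (inj₁ v))
    ≡⟨ cong₂ ℤ._+_ (A-touch i (inj₁ u)) (A-touch i (inj₁ v)) ⟨
      A i (inj₁ u) ℤ.+ A i (inj₁ v)
    ∎
    where
    open ≡-Reasoning
    h = head (edge i)
    t = tail (edge i)
    interchange : ∀ a b c d → (a ℤ.+ b) ℤ.- (c ℤ.+ d) ≡ (a ℤ.- c) ℤ.+ (b ℤ.- d)
    interchange = ℤSolver.solve-∀

  A-nonincident : ∀ {i v} → ¬ Incident v (edge i) → A i (inj₁ v) ≡ 0ℤ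
  A-nonincident {i} {v} ¬inc = ≡.trans (A-touch i (inj₁ v)) (cong₂ ℤ._-_
    (indicator-no (v ≟V head (edge i)) λ { refl → ¬inc (incident-left (head-tail (edge i))) })
    (indicator-no (v ≟V tail (edge i)) λ { refl → ¬inc (incident-left (joins-sym (head-tail (edge i)))) }))

  A-incident : ∀ {i v} → Incident v (edge i) → A i (inj₁ v) ≢ 0ℤ
  A-incident {i} {v} inc A≡0 with joins-incident (head-tail (edge i)) inc
  ... | inj₁ refl with ≡.trans (sym A≡0) (≡.trans (A-touch i (inj₁ v)) (cong₂ ℤ._-_
          (indicator-yes (v ≟V v) refl)
          (indicator-no (v ≟V tail (edge i)) (joins-distinct (head-tail (edge i))))))
  ...   | ()
  A-incident {i} {v} inc A≡0 | inj₂ refl with ≡.trans (sym A≡0) (≡.trans (A-touch i (inj₁ v)) (cong₂ ℤ._-_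
          (indicator-no (v ≟V head (edge i)) (joins-distinct (head-tail (edge i)) ∘ sym))
          (indicator-yes (v ≟V v) refl)))
  ...   | ()

  index : E → Fin ∣E∣
  index = Inverse.to enumE

  edge-index : ∀ e → edge (index e) ≡ e
  edge-index = Inverse.strictlyInverseʳ enumE

  -- Partial transversals, grown one vertex at a time

  Inside : (V → Set) → V ⊎ E → Set
  Inside D (inj₁ v) = D v
  Inside D (inj₂ e) = D (proj₁ (ends e)) × D (proj₂ (ends e))

  inside-mono : ∀ {D D′ : V → Set} → (∀ {x} → D x → D′ x) → ∀ {z} → Inside D z → Inside D′ z
  inside-mono f {inj₁ _} d       = f d
  inside-mono f {inj₂ _} (d , e) = f d , f e

  inside-joins : ∀ {D : V → Set} {e u v} → Joins e u v → D u → D v → Inside D (inj₂ e)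
  inside-joins {D} (inj₁ eq) du dv =
    subst D (sym (cong proj₁ eq)) du , subst D (sym (cong proj₂ eq)) dv
  inside-joins {D} (inj₂ eq) du dv =
    subst D (sym (cong proj₁ eq)) dv , subst D (sym (cong proj₂ eq)) du

  inside-incident : ∀ {D : V → Set} {e v} → Inside D (inj₂ e) → Incident v e → D v
  inside-incident (d , _) (inj₁ refl) = d
  inside-incident (_ , d) (inj₂ refl) = d

  -- The columns are those of w ∷ cs, where w may be a second copy of an element of cs.
  record Partial (D : V → Set) (w : V) (l : ℕ) (cs : List (V ⊎ E)) : Set where
    field
      rows        : List (Fin ∣E∣)
      size        : length rows ≡ l
      nonzero     : permanent rows (inj₁ w ∷ cs) ≢ 0ℤ
      uniqueRows  : Unique rows
      uniqueCols  : Unique cs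
      insideRows  : All (Inside D ∘ inj₂ ∘ edge) rows
      insideCols  : All (Inside D) cs

  open Partial

  weaken : ∀ {D D′ : V → Set} {w l cs} → (∀ {x} → D x → D′ x) → Partial D w l cs → Partial D′ w l cs
  weaken D⊆D′ S = record
    { rows       = rows S
    ; size       = size S
    ; nonzero    = nonzero S
    ; uniqueRows = uniqueRows S
    ; uniqueCols = uniqueCols S
    ; insideRows = All.map (λ {i} (d , d′) → D⊆D′ d , D⊆D′ d′) (insideRows S)
    ; insideCols = All.map (λ {z} → inside-mono D⊆D′ {z}) (insideCols S)
    }

  private
    *-≢0 : ∀ {x y} → x ≢ 0ℤ → y ≢ 0ℤ → x ℤ.* y ≢ 0ℤ
    *-≢0 {x} x≢0 y≢0 xy≡0 with ℤₚ.i*j≡0⇒i≡0∨j≡0 x xy≡0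
    ... | inj₁ x≡0 = x≢0 x≡0
    ... | inj₂ y≡0 = y≢0 y≡0

    edge≢ : ∀ {D : V → Set} {e v} → ¬ D v → Incident v e → ∀ {z} → Inside D z → inj₂ e ≢ z
    edge≢ {e = e} ¬Dv inc d refl = ¬Dv (inside-incident {e = e} d inc)

    vertex≢ : ∀ {D : V → Set} {v} → ¬ D v → ∀ {z} → Inside D z → inj₁ v ≢ z
    vertex≢ ¬Dv d refl = ¬Dv d

    index≢ : ∀ {D : V → Set} {e v} → ¬ D v → Incident v e → ∀ {i} → Inside D (inj₂ (edge i)) → index e ≢ i
    index≢ {e = e} ¬Dv inc d refl =
      ¬Dv (inside-incident {e = edge (index e)} d (subst (Incident _) (sym (edge-index e)) inc))

    A-index : ∀ {e v} → Incident v e → A (index e) (inj₁ v) ≢ 0ℤ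
    A-index {e} inc = A-incident (subst (Incident _) (sym (edge-index e)) inc)

  initial : ∀ {D : V → Set} {e u v} → Joins e u v → D u → D v → Partial D v 1 []
  initial {D} {e} {u} {v} j Du Dv = record
    { rows       = index e ∷ []
    ; size       = refl
    ; nonzero    = λ p≡0 → A-index (incident-left (joins-sym j))
        (≡.trans (sym (≡.trans (ℤₚ.+-identityʳ _) (ℤₚ.*-identityʳ _))) p≡0)
    ; uniqueRows = [] ∷ []
    ; uniqueCols = []
    ; insideRows = subst (Inside D ∘ inj₂) (sym (edge-index e)) (inside-joins j Du Dv) ∷ []
    ; insideCols = []
    }

  Transversal : Set
  Transversal = ∃[ cs ] Unique cs × permanent (allFin ∣E∣) cs ≢ 0ℤ

  -- The construction lists the edges in its own order; the permanent does not depend on the order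
  -- of the rows.
  transversal : ∀ rs cs → Unique rs → length rs ≡ ∣E∣ → Unique cs → permanent rs cs ≢ 0ℤ → Transversal
  transversal rs cs ur len uc p≢0 =
    cs , uc , p≢0 ∘ ≡.trans (permanent-↭ {rs} (unique⇒↭allFin ur len) cs)

  module Attach {D D′ : V → Set} {w l cs} (S : Partial D w l cs) {v f}
    (v∉D : ¬ D v) (fvw : Joins f v w) (w∈D : D w)
    (D⊆D′ : ∀ {x} → D x → D′ x) (v∈D′ : D′ v) where

    private
      vanish : All (λ i → A i (inj₁ v) ≡ 0ℤ) (rows S)
      vanish = All.map (λ {i} d → A-nonincident (v∉D ∘ inside-incident {e = edge i} d)) (insideRows S)

      -- On the old rows the column of f = vw is that of w, as v is new.
      replaced : permanent (rows S) (inj₂ f ∷ cs) ≢ 0ℤ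
      replaced = nonzero S ∘ ≡.trans (permanent-column-cong
        (All.map (λ {i} z → sym (≡.trans (A-edge fvw i)
          (≡.trans (cong (ℤ._+ A i (inj₁ w)) z) (ℤₚ.+-identityˡ _)))) vanish) cs)

      f∉cs : All (inj₂ f ≢_) cs
      f∉cs = All.map (edge≢ v∉D (incident-left fvw)) (insideCols S)

      f∉rows : All (index f ≢_) (rows S)
      f∉rows = All.map (λ {i} → index≢ v∉D (incident-left fvw) {i}) (insideRows S)

      inside : ∀ {e u} → Joins e v u → D u → Inside D′ (inj₂ e)
      inside j u∈D = inside-joins j v∈D′ (D⊆D′ u∈D)

    -- Among the rows, only `f` meets the new vertex `v`, so expanding along the extra column `v`
    -- leaves the permanent with `f` in place of the old extra column. The vertex `v` does not enter
    -- the list of proper columns.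
    attach¹ : Partial D′ v (suc l) (inj₂ f ∷ cs)
    attach¹ = record
      { rows       = index f ∷ rows S
      ; size       = cong suc (size S)
      ; nonzero    = *-≢0 (A-index (incident-left fvw)) replaced
          ∘ ≡.trans (sym (permanent-single (index f) (inj₁ v) vanish (inj₂ f ∷ cs)))
      ; uniqueRows = f∉rows ∷ uniqueRows S
      ; uniqueCols = f∉cs ∷ uniqueCols S
      ; insideRows = subst (Inside D′ ∘ inj₂) (sym (edge-index f)) (inside fvw w∈D)
                     ∷ insideRows (weaken D⊆D′ S)
      ; insideCols = inside fvw w∈D ∷ insideCols (weaken D⊆D′ S)
      }

    module _ {u g} (gvu : Joins g v u) (u∈D : D u) (u≢w : u ≢ w) where

      private
        g≢f : g ≢ f
        g≢f refl with joins-incident fvw (incident-left (joins-sym gvu))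
        ... | inj₁ refl = v∉D u∈D
        ... | inj₂ u≡w  = u≢w u≡w

      -- Two new rows require one column more than before: `v` appears both as a proper column and
      -- as the extra one. Both copies vanish outside `f` and `g`, and `permanent-double` supplies
      -- the nonzero factor.
      attach² : Partial D′ v (suc (suc l)) (inj₁ v ∷ inj₂ f ∷ cs)
      attach² = record
        { rows       = index g ∷ index f ∷ rows S
        ; size       = cong (λ t → suc (suc t)) (size S)
        ; nonzero    = *-≢0 {ℤ.+ 2} (λ ()) (*-≢0 (A-index (incident-left gvu))
                         (*-≢0 (A-index (incident-left fvw)) replaced))
            ∘ ≡.trans (sym (permanent-double (index g) (index f) (inj₁ v) vanish (inj₂ f ∷ cs)))
        ; uniqueRows = ((λ eq → g≢f (≡.trans (sym (edge-index g)) (≡.trans (cong edge eq) (edge-index f))))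
                       ∷ All.map (λ {i} → index≢ v∉D (incident-left gvu) {i}) (insideRows S))
                       ∷ uniqueRows attach¹
        ; uniqueCols = ((λ ()) ∷ All.map (vertex≢ v∉D) (insideCols S)) ∷ uniqueCols attach¹
        ; insideRows = subst (Inside D′ ∘ inj₂) (sym (edge-index g)) (inside gvu u∈D)
                       ∷ insideRows attach¹
        ; insideCols = v∈D′ ∷ insideCols attach¹
        }

      private
        rs = rows attach²
        ds : List (V ⊎ E)
        ds = inj₁ v ∷ inj₂ f ∷ cs

      -- The column of v is that of g = vu minus that of u.
      resolve : inj₁ u ∉ cs → suc (suc l) ≡ ∣E∣ → Transversal
      resolve u∉cs l≡ with permanent rs (inj₂ g ∷ ds) ℤ.≟ 0ℤ
      ... | no  p≢0 = transversal rs (inj₂ g ∷ ds) (uniqueRows attach²) (≡.trans (size attach²) l≡)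
        (((λ ()) ∷ (λ { refl → g≢f refl })
          ∷ All.map (edge≢ v∉D (incident-left gvu)) (insideCols S)) ∷ uniqueCols attach²)
        p≢0
      ... | yes p≡0 = transversal rs (inj₁ u ∷ ds) (uniqueRows attach²) (≡.trans (size attach²) l≡)
        (((λ { refl → v∉D u∈D }) ∷ (λ ()) ∷ Allₚ.¬Any⇒All¬ cs u∉cs) ∷ uniqueCols attach²)
        λ q≡0 → nonzero attach² (begin
            permanent rs (inj₁ v ∷ ds)
          ≡⟨ ℤₚ.+-identityʳ _ ⟨
            permanent rs (inj₁ v ∷ ds) ℤ.+ 0ℤ
          ≡⟨ cong (λ t → permanent rs (inj₁ v ∷ ds) ℤ.+ t) q≡0 ⟨
            permanent rs (inj₁ v ∷ ds) ℤ.+ permanent rs (inj₁ u ∷ ds)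
          ≡⟨ permanent-column-+ (inj₂ g) (inj₁ v) (inj₁ u) (A-edge gvu) rs ds ⟨
            permanent rs (inj₂ g ∷ ds)
          ≡⟨ p≡0 ⟩
            0ℤ
          ∎)
        where open ≡-Reasoning

  open Attach public

  -- If the extra column is not a repetition, no exchange remains to be done.
  close : ∀ {D w l cs} → Partial D w l cs → l ≡ ∣E∣ → inj₁ w ∉ cs → Transversal
  close {w = w} {cs = cs} S l≡ w∉cs = transversal (rows S) (inj₁ w ∷ cs) (uniqueRows S) (≡.trans (size S) l≡)
    (Allₚ.¬Any⇒All¬ cs w∉cs ∷ uniqueCols S) (nonzero S)

  -- Each new vertex of a path has one edge back, so `attach¹` suffices throughout and every proper
  -- column is an edge. This handles grids that are paths and the first row of all others.
  pathPartial : ∀ k (p : Fin (suc (suc k)) → V) → (∀ {i j} → p i ≡ p j → i ≡ j) →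
    (e : Fin (suc k) → E) → (∀ i → Joins (e i) (p (inject₁ i)) (p (suc i))) →
    ∃[ cs ] Partial (λ x → ∃[ i ] x ≡ p i) (p (fromℕ (suc k))) (suc k) cs × (∀ v → inj₁ v ∉ cs)
  pathPartial k p p-inj e joins =
    let cs , S , noV = <-weakInduction Q Q₀ Q₊ (fromℕ k) in cs
    , weaken (λ (j , eq , _) → j , eq)
        (subst (λ t → Partial (D (fromℕ k)) (p (fromℕ (suc k))) (suc t) cs) (Finₚ.toℕ-fromℕ k) S)
    , noV
    where
    -- After the edge `e i` the path has reached `p (suc i)`, whence the bound `suc (toℕ i)` on
    -- positions.
    D : Fin (suc k) → V → Set
    D i x = ∃[ j ] x ≡ p j × toℕ j ℕ.≤ suc (toℕ i)
    Q : Fin (suc k) → Set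
    Q i = ∃[ cs ] Partial (D i) (p (suc i)) (suc (toℕ i)) cs × (∀ v → inj₁ v ∉ cs)
    Q₀ : Q zero
    Q₀ = [] , initial (joins zero) (zero , refl , z≤n) (suc zero , refl , ℕₚ.≤-refl) , λ _ ()
    Q₊ : ∀ i → Q (inject₁ i) → Q (suc i)
    Q₊ i (cs , S , noV) = _
      , subst (λ t → Partial (D (suc i)) (p (suc (suc i))) (suc (suc t)) (inj₂ (e (suc i)) ∷ cs)) (Finₚ.toℕ-inject₁ i)
          (attach¹ S
            (λ (j , eq , j≤) → ℕₚ.1+n≰n (subst (ℕ._≤ _) (cong toℕ (sym (p-inj eq)))
              (ℕₚ.≤-trans j≤ (s≤s (ℕₚ.≤-reflexive (Finₚ.toℕ-inject₁ i))))))
            (joins-sym (joins (suc i)))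
            (suc (inject₁ i) , refl , ℕₚ.≤-refl)
            (λ (j , eq , j≤) → j , eq , ℕₚ.≤-trans j≤ (s≤s (ℕₚ.≤-trans (ℕₚ.≤-reflexive (Finₚ.toℕ-inject₁ i)) (ℕₚ.n≤1+n _))))
            (suc (suc i) , refl , ℕₚ.≤-refl))
      , λ { v (there v∈cs) → noV v v∈cs }

-- A list of distinct columns uses each column at most once, and 1 is the least value that the
-- definition admits. The nonzero permanent forces the number of columns to be that of the rows.
transversal⇒Pind : (G : Graph) → (∀ o → GraphMatrix.Transversal G o) → Pind G 1
transversal⇒Pind G t o with t o
... | cs , unique , p≢0
  with tabulate-onto cs (≡.trans (GraphMatrix.permanent-length G o (allFin (Graph.∣E∣ G)) cs p≢0) (Listₚ.length-tabulate {n = Graph.∣E∣ G} id))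
... | c , refl = s≤s z≤n , (c , p≢0 ∘ ≡.trans (sym (per-permanent (matrixA G o) id c)) , once) , λ _ 1≤k _ → 1≤k
  where
  open Graph G
  once : ∀ z → occurrences _≟VE_ z c ℕ.≤ 1
  once z = unique-constant⇒length≤1 (filter⁺ (λ i → c i ≟VE z) (allFin⁺ ∣E∣)) λ i∈ j∈ →
    tabulate-injective unique (≡.trans (at-z i∈) (sym (at-z j∈)))
    where
    at-z : ∀ {i} → i ∈ filter (λ i → c i ≟VE z) (allFin ∣E∣) → c i ≡ z
    at-z {i} i∈ = All.lookup (Allₚ.all-filter (λ i → c i ≟VE z) (allFin ∣E∣)) i∈

-- The snake

opposite-inject₁ : ∀ {k} (i : Fin k) → opposite (inject₁ i) ≡ suc (opposite i)
opposite-inject₁ zero    = refl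
opposite-inject₁ (suc i) = cong inject₁ (opposite-inject₁ i)

opposite-fromℕ : ∀ k → opposite (fromℕ k) ≡ zero
opposite-fromℕ k = Finₚ.opposite-involutive zero

-- Converts between columns of the grid and positions along the snake, which runs backwards in a row
-- marked `true`.
dir : ∀ {k} → Bool → Fin k → Fin k
dir false j = j
dir true  j = opposite j

dir-involutive : ∀ {k} b (j : Fin k) → dir b (dir b j) ≡ j
dir-involutive false j = refl
dir-involutive true  j = Finₚ.opposite-involutive j

dir-injective : ∀ {k} b {j j′ : Fin k} → dir b j ≡ dir b j′ → j ≡ j′
dir-injective b {j} {j′} eq =
  ≡.trans (sym (dir-involutive b j)) (≡.trans (cong (dir b) eq) (dir-involutive b j′))

dir-not-zero : ∀ {k} b → dir (not b) zero ≡ dir b (fromℕ k)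
dir-not-zero {k} false = refl
dir-not-zero {k} true  = sym (opposite-fromℕ k)

dir-not-last : ∀ {k} b → dir (not b) (fromℕ k) ≡ dir b zero
dir-not-last {k} false = opposite-fromℕ k
dir-not-last {k} true  = refl

horizontal : ∀ {n m} → Fin n → Fin m → GridE n (suc m)
horizontal i k = ((i , inject₁ k) , (i , suc k)) , inj₁ (refl , cong suc (sym (Finₚ.toℕ-inject₁ k)))

vertical : ∀ {n m} → Fin n → Fin m → GridE (suc n) m
vertical k j = ((inject₁ k , j) , (suc k , j)) , inj₂ (cong suc (sym (Finₚ.toℕ-inject₁ k)) , refl)

module Snake (n m : ℕ) (o : Orientation (grid (suc (suc n)) (suc (suc m)))) where
  open GraphMatrix (grid (suc (suc n)) (suc (suc m))) o

  Vertex : Set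
  Vertex = GridV (suc (suc n)) (suc (suc m))

  along : ∀ b i k → ∃[ e ] Joins e (i , dir b (suc k)) (i , dir b (inject₁ k))
  along false i k = horizontal i k , inj₂ refl
  along true  i k = horizontal i (opposite k)
    , inj₁ (cong (λ j → (i , inject₁ (opposite k)) , (i , j)) (sym (opposite-inject₁ k)))

  UpTo : Fin (suc (suc n)) → Vertex → Set
  UpTo i (i′ , _) = toℕ i′ ℕ.≤ toℕ i

  -- The first row has `suc m` edges; every later row brings `suc m` horizontal and `suc (suc m)`
  -- vertical ones. The first vertex of the row is kept out of the columns because the following row
  -- ends below it, where the final exchange may need it.
  RowEnd : Fin (suc (suc n)) → Set
  RowEnd i = ∃[ b ] ∃[ cs ]
    Partial (UpTo i) (i , dir b (fromℕ _)) (suc m ℕ.+ toℕ i ℕ.* suc (2 ℕ.* suc m)) cs ×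
    inj₁ (i , dir b zero) ∉ cs

  firstRow : RowEnd zero
  firstRow =
    let cs , S , noV = pathPartial m (zero ,_) (λ { refl → refl }) (horizontal zero) (λ _ → inj₁ refl)
    in false , cs
      , subst (λ l → Partial (UpTo zero) (zero , fromℕ _) l cs) (sym (ℕₚ.+-identityʳ (suc m)))
          (weaken (λ { (_ , refl) → z≤n }) S)
      , noV _

  module NextRow (k : Fin (suc n)) (b : Bool) {l cs}
    (S : Partial (UpTo (inject₁ k)) (inject₁ k , dir b (fromℕ _)) l cs)
    (start∉cs : inj₁ (inject₁ k , dir b zero) ∉ cs) where

    below : ∀ {x : Vertex} → UpTo (inject₁ k) x → toℕ (proj₁ x) ℕ.< toℕ (Fin.suc k)
    below {x} le = s≤s (subst (toℕ (proj₁ x) ℕ.≤_) (Finₚ.toℕ-inject₁ k) le)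

    -- As `dir (not b)` is an involution, it sends the column of a vertex to its position in the
    -- sweep.
    Done : Fin (suc (suc m)) → Vertex → Set
    Done t x = toℕ (proj₁ x) ℕ.< toℕ (Fin.suc k)
             ⊎ (proj₁ x ≡ suc k × toℕ (dir (not b) (proj₂ x)) ℕ.≤ toℕ t)

    done-here : ∀ {t t′} → toℕ t ℕ.≤ toℕ t′ → Done t′ (suc k , dir (not b) t)
    done-here {t} {t′} le =
      inj₂ (refl , subst (λ j → toℕ j ℕ.≤ toℕ t′) (sym (dir-involutive (not b) t)) le)

    inject₁≢suc : ∀ {j j′ : Fin (suc (suc m))} → _≢_ {A = Vertex} (inject₁ k , j) (suc k , j′)
    inject₁≢suc eq = ℕₚ.1+n≢n
      (sym (≡.trans (sym (Finₚ.toℕ-inject₁ k)) (cong (toℕ ∘ proj₁) eq)))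

    down : ∀ j → Joins (vertical k j) (suc k , j) (inject₁ k , j)
    down j = inj₂ refl

    -- Position 0 adds one vertical edge, each later position a vertical and a horizontal one. The
    -- first exclusion is handed on to the next row; the second is for the exchange at the end of
    -- the grid.
    Swept : Fin (suc (suc m)) → Set
    Swept t = ∃[ ds ] Partial (Done t) (suc k , dir (not b) t) (suc l ℕ.+ 2 ℕ.* toℕ t) ds ×
      inj₁ (suc k , dir (not b) zero) ∉ ds × inj₁ (inject₁ k , dir b zero) ∉ ds

    sweep₀ : Swept zero
    sweep₀ = _
      , subst (λ l → Partial (Done zero) (suc k , dir (not b) zero) l (inj₂ (vertical k (dir (not b) zero)) ∷ cs))
          (sym (ℕₚ.+-identityʳ (suc l)))
          (attach¹ S new
            -- The sweep starts below the vertex where the previous row ended, which is the current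
            -- extra column.
            (subst (λ j → Joins (vertical k (dir (not b) zero)) (suc k , dir (not b) zero) (inject₁ k , j))
              (dir-not-zero b) (down (dir (not b) zero)))
            ℕₚ.≤-refl (λ {x} → inj₁ ∘ below {x}) (done-here {zero} {zero} z≤n))
      , (λ { (there v∈cs) → new (All.lookup (Partial.insideCols S) v∈cs) })
      , λ { (there s∈cs) → start∉cs s∈cs }
      where
      new : ¬ UpTo (inject₁ k) (suc k , dir (not b) zero)
      new le = ℕₚ.<-irrefl refl (below {suc k , dir (not b) zero} le)

    module _ (t : Fin (suc m)) where

      done-mono : ∀ {x} → Done (inject₁ t) x → Done (suc t) x
      done-mono (inj₁ lt)        = inj₁ lt
      done-mono (inj₂ (eq , le)) = inj₂ (eq , ℕₚ.≤-trans le
        (ℕₚ.≤-trans (ℕₚ.≤-reflexive (Finₚ.toℕ-inject₁ t)) (ℕₚ.n≤1+n _)))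

      ahead : ¬ Done (inject₁ t) (suc k , dir (not b) (suc t))
      ahead (inj₁ lt)       = ℕₚ.<-irrefl refl lt
      ahead (inj₂ (_ , le)) = ℕₚ.1+n≰n (ℕₚ.≤-trans
        (subst (λ j → toℕ j ℕ.≤ toℕ (inject₁ t)) (dir-involutive (not b) (suc t)) le)
        (ℕₚ.≤-reflexive (Finₚ.toℕ-inject₁ t)))

      belowDone : Done (inject₁ t) (inject₁ k , dir (not b) (suc t))
      belowDone = inj₁ (below {inject₁ k , dir (not b) (suc t)} ℕₚ.≤-refl)

      module Corner {ds} (T : Partial (Done (inject₁ t)) (suc k , dir (not b) (inject₁ t))
                                      (suc l ℕ.+ 2 ℕ.* toℕ (inject₁ t)) ds) =
        Attach {D′ = Done (suc t)} T {f = proj₁ (along (not b) (suc k) t)} ahead (proj₂ (along (not b) (suc k) t)) (done-here ℕₚ.≤-refl)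
          done-mono (done-here ℕₚ.≤-refl)

    -- In `attach²` the horizontal edge back along the row plays `f` and the vertical edge plays
    -- `g`. The new vertex column lies in the new row at a positive position, so both excluded
    -- vertices stay excluded.
    sweep : ∀ t → Swept t
    sweep = <-weakInduction Swept sweep₀ λ t (ds , T , v∉ , s∉) → _
      , subst (λ l → Partial (Done (suc t)) (suc k , dir (not b) (suc t)) l
            (inj₁ (suc k , dir (not b) (suc t)) ∷ inj₂ (proj₁ (along (not b) (suc k) t)) ∷ ds)) (count t)
          (Corner.attach² t T {g = vertical k (dir (not b) (suc t))} (down (dir (not b) (suc t))) (belowDone t) inject₁≢suc)
      , (λ { (here eq) → Finₚ.0≢1+n (dir-injective (not b) (cong proj₂ (inj₁-injective eq)))
           ; (there (there v∈)) → v∉ v∈ })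
      , (λ { (here eq) → inject₁≢suc (inj₁-injective eq)
           ; (there (there s∈)) → s∉ s∈ })
      where
      arith : ∀ a b → suc (suc (suc a ℕ.+ 2 ℕ.* b)) ≡ suc a ℕ.+ 2 ℕ.* suc b
      arith = ℕSolver.solve-∀
      count : ∀ t → suc (suc (suc l ℕ.+ 2 ℕ.* toℕ (inject₁ t))) ≡ suc l ℕ.+ 2 ℕ.* toℕ (Fin.suc t)
      count t = ≡.trans (cong (λ a → suc (suc (suc l ℕ.+ 2 ℕ.* a))) (Finₚ.toℕ-inject₁ t)) (arith l (toℕ t))

    finish : suc (suc (suc l ℕ.+ 2 ℕ.* m)) ≡ Graph.∣E∣ (grid (suc (suc n)) (suc (suc m))) → Transversal
    finish l≡ =
      let ds , T , _ , s∉ = sweep (inject₁ (fromℕ m)) in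
      Corner.resolve (fromℕ m) T {g = vertical k (dir (not b) (suc (fromℕ m)))} (down (dir (not b) (suc (fromℕ m)))) (belowDone (fromℕ m)) inject₁≢suc
        (subst (λ j → inj₁ (inject₁ k , j) ∉ ds) (sym (dir-not-last b)) s∉)
        (≡.trans (cong (λ a → suc (suc (suc l ℕ.+ 2 ℕ.* a)))
          (≡.trans (Finₚ.toℕ-inject₁ (fromℕ m)) (Finₚ.toℕ-fromℕ m))) l≡)

  rowEnd : ∀ i → RowEnd i
  rowEnd = <-weakInduction RowEnd firstRow λ k (b , cs , S , s∉) →
    let open NextRow k b S s∉
        ds , T , v∉ , _ = sweep (fromℕ (suc m))
    in not b , ds
      , subst (λ l → Partial (UpTo (suc k)) (suc k , dir (not b) (fromℕ (suc m))) l ds) (count k)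
          (weaken (λ { (inj₁ lt) → ℕₚ.<⇒≤ lt ; (inj₂ (refl , _)) → ℕₚ.≤-refl }) T)
      , v∉
    where
    arith : ∀ a c → suc (suc a ℕ.+ c ℕ.* suc (2 ℕ.* suc a)) ℕ.+ 2 ℕ.* suc a ≡ suc a ℕ.+ suc c ℕ.* suc (2 ℕ.* suc a)
    arith = ℕSolver.solve-∀
    count : ∀ k → suc (suc m ℕ.+ toℕ (inject₁ k) ℕ.* suc (2 ℕ.* suc m)) ℕ.+ 2 ℕ.* toℕ (fromℕ (suc m)) ≡
            suc m ℕ.+ toℕ (Fin.suc k) ℕ.* suc (2 ℕ.* suc m)
    count k = ≡.trans
      (cong₂ (λ c d → suc (suc m ℕ.+ c ℕ.* suc (2 ℕ.* suc m)) ℕ.+ 2 ℕ.* d)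
        (Finₚ.toℕ-inject₁ k) (Finₚ.toℕ-fromℕ (suc m)))
      (arith m (toℕ k))

  snake : Transversal
  snake =
    -- All rows but the last are complete here; `finish` supplies the last one.
    let b , cs , S , s∉ = rowEnd (inject₁ (fromℕ n)) in
    NextRow.finish (fromℕ n) b S s∉ (≡.trans
      (cong (λ c → suc (suc (suc (suc m ℕ.+ c ℕ.* suc (2 ℕ.* suc m)) ℕ.+ 2 ℕ.* m)))
        (≡.trans (Finₚ.toℕ-inject₁ (fromℕ n)) (Finₚ.toℕ-fromℕ n)))
      (arith n m))
    where
    arith : ∀ c a → suc (suc (suc (suc a ℕ.+ c ℕ.* suc (2 ℕ.* suc a)) ℕ.+ 2 ℕ.* a)) ≡
            suc (suc c) ℕ.* suc a ℕ.+ suc c ℕ.* suc (suc a)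
    arith = ℕSolver.solve-∀

-- The snake with its final exchange requires two rows and two columns. In a path the end vertex is
-- no proper column, so `close` applies; a single vertex leaves the empty permanent, which is 1.
gridTransversal : ∀ n m (o : Orientation (grid (suc n) (suc m))) → GraphMatrix.Transversal (grid (suc n) (suc m)) o
gridTransversal zero    zero    o = [] , [] , λ ()
gridTransversal zero    (suc m) o =
  let open GraphMatrix (grid 1 (suc (suc m))) o
      cs , S , noV = pathPartial m (zero ,_) (λ { refl → refl }) (horizontal zero) (λ _ → inj₁ refl)
  in close S (arith m) (noV _)
  where
  arith : ∀ m → suc m ≡ 1 ℕ.* suc m ℕ.+ 0 ℕ.* suc (suc m)
  arith = ℕSolver.solve-∀
gridTransversal (suc n) zero    o =
  let open GraphMatrix (grid (suc (suc n)) 1) o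
      cs , S , noV = pathPartial n (_, zero) (λ { refl → refl }) (λ k → vertical k zero) (λ _ → inj₁ refl)
  in close S (arith n) (noV _)
  where
  arith : ∀ n → suc n ≡ suc (suc n) ℕ.* 0 ℕ.+ suc n ℕ.* 1
  arith = ℕSolver.solve-∀
gridTransversal (suc n) (suc m) o = Snake.snake n m o

-- The combinatorial Nullstellensatz

module _ where
  open import Data.Rational using (_+_; _*_; _-_; _≤_; _<_; ∣_∣)

  ℚ-ring : AlmostCommutativeRing 0ℓ 0ℓ
  ℚ-ring = fromCommutativeRing ℚₚ.+-*-commutativeRing (λ x → dec⇒maybe (0ℚ ℚₚ.≟ x))

  -- Passing through unnormalised fractions with denominator 1 turns the homomorphism laws into
  -- integer identities.
  fromℤ : ℤ → ℚ
  fromℤ i = ℚ.fromℚᵘ (mkℚᵘ i 0)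

  private
    fromℤ-via : ∀ i {q} → mkℚᵘ i 0 ℚᵘ.≃ ℚ.toℚᵘ q → fromℤ i ≡ q
    fromℤ-via i eq = ℚₚ.toℚᵘ-injective (ℚᵘₚ.≃-trans (ℚₚ.toℚᵘ-fromℚᵘ (mkℚᵘ i 0)) eq)

  fromℤ-+ : ∀ i j → fromℤ (i ℤ.+ j) ≡ fromℤ i + fromℤ j
  fromℤ-+ i j = fromℤ-via (i ℤ.+ j) (ℚᵘₚ.≃-trans (*≡* (arith i j)) (ℚᵘₚ.≃-sym (ℚᵘₚ.≃-trans
    (ℚₚ.toℚᵘ-homo-+ (fromℤ i) (fromℤ j))
    (ℚᵘₚ.+-cong (ℚₚ.toℚᵘ-fromℚᵘ (mkℚᵘ i 0)) (ℚₚ.toℚᵘ-fromℚᵘ (mkℚᵘ j 0))))))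
    where
    arith : ∀ i j → (i ℤ.+ j) ℤ.* 1ℤ ≡ (i ℤ.* 1ℤ ℤ.+ j ℤ.* 1ℤ) ℤ.* 1ℤ
    arith = ℤSolver.solve-∀

  fromℤ-* : ∀ i j → fromℤ (i ℤ.* j) ≡ fromℤ i * fromℤ j
  fromℤ-* i j = fromℤ-via (i ℤ.* j) (ℚᵘₚ.≃-trans (*≡* refl) (ℚᵘₚ.≃-sym (ℚᵘₚ.≃-trans
    (ℚₚ.toℚᵘ-homo-* (fromℤ i) (fromℤ j))
    (ℚᵘₚ.*-cong (ℚₚ.toℚᵘ-fromℚᵘ (mkℚᵘ i 0)) (ℚₚ.toℚᵘ-fromℚᵘ (mkℚᵘ j 0))))))

  fromℤ-neg : ∀ i → fromℤ (ℤ.- i) ≡ ℚ.- fromℤ i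
  fromℤ-neg i = fromℤ-via (ℤ.- i) (ℚᵘₚ.≃-trans (*≡* refl) (ℚᵘₚ.≃-sym (ℚᵘₚ.≃-trans
    (ℚₚ.toℚᵘ-homo‿- (fromℤ i)) (ℚᵘₚ.-‿cong (ℚₚ.toℚᵘ-fromℚᵘ (mkℚᵘ i 0))))))

  1≤∣fromℤ∣ : ∀ i → i ≢ 0ℤ → 1ℚ ≤ ∣ fromℤ i ∣
  1≤∣fromℤ∣ i i≢0 = ℚₚ.toℚᵘ-cancel-≤ (ℚᵘₚ.≤-trans (ℚᵘ.*≤* (one≤ i i≢0)) (ℚᵘₚ.≤-reflexive (ℚᵘₚ.≃-sym
    (ℚᵘₚ.≃-trans (ℚₚ.toℚᵘ-homo-∣-∣ (fromℤ i)) (ℚᵘₚ.∣-∣-cong (ℚₚ.toℚᵘ-fromℚᵘ (mkℚᵘ i 0)))))))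
    where
    one≤ : ∀ i → i ≢ 0ℤ → 1ℤ ℤ.* 1ℤ ℤ.≤ ℤ.+ ℤ.∣ i ∣ ℤ.* 1ℤ
    one≤ ℤ.+0       i≢0 = contradiction refl i≢0
    one≤ ℤ.+[1+ n ] i≢0 = ℤ.+≤+ (s≤s z≤n)
    one≤ ℤ.-[1+ n ] i≢0 = ℤ.+≤+ (s≤s z≤n)

  -- Bounds for products of rationals

  half-pos : ∀ {ε} → 0ℚ < ε → 0ℚ < ½ * ε
  half-pos {ε} ε>0 = subst (_< ½ * ε) (ℚₚ.*-zeroʳ ½) (ℚₚ.*-monoʳ-<-pos ½ ε>0)

  half+half : ∀ ε → ½ * ε + ½ * ε ≡ ε
  half+half ε = ≡.trans (sym (ℚₚ.*-distribʳ-+ ε ½ ½)) (ℚₚ.*-identityˡ ε)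

  *-mono-≤ : ∀ {p q r s} → 0ℚ ≤ p → p ≤ q → 0ℚ ≤ r → r ≤ s → p * r ≤ q * s
  *-mono-≤ {p} {q} {r} {s} 0≤p p≤q 0≤r r≤s = ℚₚ.≤-trans
    (ℚₚ.*-monoʳ-≤-nonNeg r {{ℚ.nonNegative 0≤r}} p≤q)
    (ℚₚ.*-monoˡ-≤-nonNeg q {{ℚ.nonNegative (ℚₚ.≤-trans 0≤p p≤q)}} r≤s)

  *-pos : ∀ {p q} → 0ℚ < p → 0ℚ < q → 0ℚ < p * q
  *-pos {p} {q} p>0 q>0 = ℚₚ.positive⁻¹ (p * q)
    {{ℚₚ.pos*pos⇒pos p {{ℚ.positive p>0}} q {{ℚ.positive q>0}}}}

  divide : ∀ {p q} → 0ℚ < p → 0ℚ < q → ∃[ ε ] 0ℚ < ε × ε * q ≡ p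
  divide {p} {q} p>0 q>0 = p * (ℚ.1/ q)
    , *-pos p>0 (ℚₚ.positive⁻¹ (ℚ.1/ q) {{ℚₚ.1/pos⇒pos q}})
    , ≡.trans (ℚₚ.*-assoc p (ℚ.1/ q) q) (≡.trans (cong (p *_) (ℚₚ.*-inverseˡ q)) (ℚₚ.*-identityʳ p))
    where
    instance
      q-pos : ℚ.Positive q
      q-pos = ℚ.positive q>0
      q-nonZero : ℚ.NonZero q
      q-nonZero = ℚₚ.pos⇒nonZero q

  -- A reverse triangle inequality, proved by contradiction since the order on the rationals is
  -- decidable.
  ∣-∣-stable : ∀ {ε} p q → ε ≤ ∣ p ∣ → ∣ p - q ∣ < ½ * ε → ½ * ε ≤ ∣ q ∣
  ∣-∣-stable {ε} p q ε≤∣p∣ close = ℚₚ.≮⇒≥ λ ∣q∣< → ℚₚ.<-irrefl refl (begin-strict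
      ε                      ≤⟨ ε≤∣p∣ ⟩
      ∣ p ∣                  ≡⟨ cong ∣_∣ (cancel p q) ⟨
      ∣ (p - q) + q ∣        ≤⟨ ℚₚ.∣p+q∣≤∣p∣+∣q∣ (p - q) q ⟩
      ∣ p - q ∣ + ∣ q ∣      <⟨ ℚₚ.+-mono-< close ∣q∣< ⟩
      ½ * ε + ½ * ε          ≡⟨ half+half ε ⟩
      ε                      ∎)
    where
    open ℚₚ.≤-Reasoning
    cancel : ∀ p q → (p - q) + q ≡ p
    cancel = solve-∀ ℚ-ring

  product : List ℚ → ℚ
  product = foldr _*_ 1ℚ

  private
    infixr 8 _^_
    _^_ : ℚ → ℕ → ℚ
    b ^ zero  = 1ℚ
    b ^ suc k = b * b ^ k

    0≤1 : 0ℚ ≤ 1ℚ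
    0≤1 = ℚₚ.nonNegative⁻¹ 1ℚ

    0<1 : 0ℚ < 1ℚ
    0<1 = ℚₚ.positive⁻¹ 1ℚ

    ^-pos : ∀ {b} → 1ℚ ≤ b → ∀ k → 0ℚ < b ^ k
    ^-pos 1≤b zero    = 0<1
    ^-pos 1≤b (suc k) = *-pos (ℚₚ.<-≤-trans 0<1 1≤b) (^-pos 1≤b k)

    product-bound : ∀ {b} → 1ℚ ≤ b → ∀ {vs} → All (λ v → ∣ v ∣ ≤ b) vs →
                    ∣ product vs ∣ ≤ b ^ length vs
    product-bound 1≤b []                   = ℚₚ.≤-refl
    product-bound 1≤b {v ∷ vs} (v≤b ∷ vs≤b) = ℚₚ.≤-trans
      (ℚₚ.≤-reflexive (ℚₚ.∣p*q∣≡∣p∣*∣q∣ v (product vs)))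
      (*-mono-≤ (ℚₚ.0≤∣p∣ v) v≤b (ℚₚ.0≤∣p∣ (product vs)) (product-bound 1≤b vs≤b))

    -- The factors other than `v` are at most `b`. As `1ℚ ≤ b`, the exponent may count `v` too,
    -- which keeps it the same for all factors.
    factor-bound : ∀ {b} → 1ℚ ≤ b → ∀ {vs} → All (λ v → ∣ v ∣ ≤ b) vs →
                   All (λ v → ∣ product vs ∣ ≤ ∣ v ∣ * b ^ length vs) vs
    factor-bound 1≤b []                         = []
    factor-bound {b} 1≤b {v ∷ vs} (v≤b ∷ vs≤b) =
      ℚₚ.≤-trans split (*-mono-≤ (ℚₚ.0≤∣p∣ v) ℚₚ.≤-refl (ℚₚ.0≤∣p∣ (product vs))
        (ℚₚ.≤-trans (product-bound 1≤b vs≤b) grow))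
      ∷ All.map (λ {w} h → ℚₚ.≤-trans split (ℚₚ.≤-trans
          (*-mono-≤ (ℚₚ.0≤∣p∣ v) v≤b (ℚₚ.0≤∣p∣ (product vs)) h)
          (ℚₚ.≤-reflexive (exchange b ∣ w ∣ (b ^ length vs)))))
        (factor-bound 1≤b vs≤b)
      where
      split : ∣ v * product vs ∣ ≤ ∣ v ∣ * ∣ product vs ∣
      split = ℚₚ.≤-reflexive (ℚₚ.∣p*q∣≡∣p∣*∣q∣ v (product vs))
      grow : b ^ length vs ≤ b * b ^ length vs
      grow = ℚₚ.≤-trans (ℚₚ.≤-reflexive (sym (ℚₚ.*-identityˡ (b ^ length vs))))
        (*-mono-≤ 0≤1 1≤b (ℚₚ.<⇒≤ (^-pos 1≤b (length vs))) ℚₚ.≤-refl)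
      exchange : ∀ x y z → x * (y * z) ≡ y * (x * z)
      exchange = solve-∀ ℚ-ring

  -- Take `ε` to be `η` divided by `b ^ k`. It is fixed before the list of factors, so that it can
  -- decide how late an index must be chosen.
  factors-away : ∀ {b η} → 1ℚ ≤ b → 0ℚ < η → ∀ k → ∃[ ε ] 0ℚ < ε ×
    (∀ vs → length vs ≡ k → All (λ v → ∣ v ∣ ≤ b) vs → η ≤ ∣ product vs ∣ → All (λ v → ε ≤ ∣ v ∣) vs)
  factors-away {b} {η} 1≤b η>0 k =
    let ε , ε>0 , εb≡η = divide η>0 (^-pos 1≤b k) in ε , ε>0 , λ { vs refl vs≤b η≤ →
      All.map (λ h → ℚₚ.*-cancelʳ-≤-pos (b ^ length vs) {{ℚ.positive (^-pos 1≤b (length vs))}}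
        (ℚₚ.≤-trans (ℚₚ.≤-reflexive εb≡η) (ℚₚ.≤-trans η≤ h))) (factor-bound 1≤b vs≤b) }

  -- The alternating sum over the Boolean cube, written as an iterated difference.
  Δ : ∀ k → (Vec Bool k → ℚ) → ℚ
  Δ zero    f = f []
  Δ (suc k) f = Δ k (f ∘ (true ∷_)) - Δ k (f ∘ (false ∷_))

  Δ-cong : ∀ k {f g : Vec Bool k → ℚ} → (∀ xs → f xs ≡ g xs) → Δ k f ≡ Δ k g
  Δ-cong zero    f≡g = f≡g []
  Δ-cong (suc k) f≡g = cong₂ _-_ (Δ-cong k (f≡g ∘ (true ∷_))) (Δ-cong k (f≡g ∘ (false ∷_)))

  Δ-+ : ∀ k f g → Δ k (λ xs → f xs + g xs) ≡ Δ k f + Δ k g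
  Δ-+ zero    f g = refl
  Δ-+ (suc k) f g = ≡.trans
    (cong₂ _-_ (Δ-+ k (f ∘ (true ∷_)) (g ∘ (true ∷_))) (Δ-+ k (f ∘ (false ∷_)) (g ∘ (false ∷_))))
    (interchange (Δ k (f ∘ (true ∷_))) (Δ k (g ∘ (true ∷_))) (Δ k (f ∘ (false ∷_))) (Δ k (g ∘ (false ∷_))))
    where
    interchange : ∀ a b c d → (a + b) - (c + d) ≡ (a - c) + (b - d)
    interchange = solve-∀ ℚ-ring

  Δ-* : ∀ k p f → Δ k (λ xs → p * f xs) ≡ p * Δ k f
  Δ-* zero    p f = refl
  Δ-* (suc k) p f = ≡.trans
    (cong₂ _-_ (Δ-* k p (f ∘ (true ∷_))) (Δ-* k p (f ∘ (false ∷_))))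
    (distrib p (Δ k (f ∘ (true ∷_))) (Δ k (f ∘ (false ∷_))))
    where
    distrib : ∀ p a b → p * a - p * b ≡ p * (a - b)
    distrib = solve-∀ ℚ-ring

  -- If two numbers differ by at least `η`, one of them has absolute value at least `½ * η`, and
  -- comparing rationals decides which. The bound `ε` depends on `k` and `η` only, not on `f`.
  Δ-large : ∀ k {η} → 0ℚ < η → ∃[ ε ] 0ℚ < ε × (∀ f → η ≤ ∣ Δ k f ∣ → ∃[ xs ] ε ≤ ∣ f xs ∣)
  Δ-large zero    {η} η>0 = η , η>0 , λ f h → [] , h
  Δ-large (suc k) {η} η>0 with Δ-large k (half-pos η>0)
  ... | ε , ε>0 , find = ε , ε>0 , λ f h → split f h (½ * η ℚₚ.≤? ∣ Δ k (f ∘ (true ∷_)) ∣)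
    where
    split : ∀ f → η ≤ ∣ Δ (suc k) f ∣ → Dec (½ * η ≤ ∣ Δ k (f ∘ (true ∷_)) ∣) → ∃[ xs ] ε ≤ ∣ f xs ∣
    split f h (yes p) = let xs , q = find _ p in true ∷ xs , q
    split f h (no ¬p) = let xs , q = find _ other in false ∷ xs , q
      where
      open ℚₚ.≤-Reasoning
      x = Δ k (f ∘ (true ∷_))
      y = Δ k (f ∘ (false ∷_))
      other : ½ * η ≤ ∣ y ∣
      other = ℚₚ.≮⇒≥ λ y< → ℚₚ.<-irrefl refl (begin-strict
        η              ≤⟨ h ⟩
        ∣ x - y ∣      ≤⟨ ℚₚ.∣p-q∣≤∣p∣+∣q∣ x y ⟩
        ∣ x ∣ + ∣ y ∣  <⟨ ℚₚ.+-mono-< (ℚₚ.≰⇒> ¬p) y< ⟩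
        ½ * η + ½ * η  ≡⟨ half+half η ⟩
        η              ∎)

  module Nullstellensatz {R C : Set} (a : R → C → ℤ) (d : C → ℚ) where
    open Permanent a

    -- Changing the bit of `c` changes `F` by the same amount whatever the other bits are: the
    -- matrix entry times the gap `d c`.
    Affine : R → (cs : List C) → (Vec Bool (length cs) → ℚ) → Set
    Affine r []       F = ⊤
    Affine r (c ∷ cs) F =
      (∀ xs → F (true ∷ xs) - F (false ∷ xs) ≡ fromℤ (a r c) * d c) ×
      (∀ b → Affine r cs (F ∘ (b ∷_)))

    Form : List C → Set
    Form cs = Σ R λ r → Σ (Vec Bool (length cs) → ℚ) (Affine r cs)

    row : ∀ {cs} → Form cs → R
    row = proj₁

    value : ∀ {cs} → Form cs → Vec Bool (length cs) → ℚ
    value = proj₁ ∘ proj₂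

    restrict : ∀ {c cs} → Bool → Form (c ∷ cs) → Form cs
    restrict b (r , F , _ , affine) = r , F ∘ (b ∷_) , affine b

    evaluate : ∀ {cs} → List (Form cs) → Vec Bool (length cs) → ℚ
    evaluate Fs xs = product (map (λ F → value F xs) Fs)

    scale : List C → ℚ
    scale = product ∘ map d

    private
      evaluate-restrict : ∀ {c cs} b (Fs : List (Form (c ∷ cs))) xs →
        evaluate Fs (b ∷ xs) ≡ evaluate (map (restrict b) Fs) xs
      evaluate-restrict b Fs xs = cong product (Listₚ.map-∘ Fs)

      evaluate-middle : ∀ {cs} (Gs : List (Form cs)) F Hs xs →
        evaluate (Gs ++ F ∷ Hs) xs ≡ value F xs * evaluate (Gs ++ Hs) xs
      evaluate-middle []       F Hs xs = refl
      evaluate-middle (G ∷ Gs) F Hs xs = ≡.trans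
        (cong (value G xs *_) (evaluate-middle Gs F Hs xs)) (exchange (value G xs) (value F xs) _)
        where
        exchange : ∀ x y z → x * (y * z) ≡ y * (x * z)
        exchange = solve-∀ ℚ-ring

      rows-restrict : ∀ {c cs} b (Fs : List (Form (c ∷ cs))) → map row (map (restrict b) Fs) ≡ map row Fs
      rows-restrict b Fs = sym (Listₚ.map-∘ Fs)

    -- The coefficient formula behind Alon's theorem: only the multilinear top
    -- coefficient of the product of affine forms survives the iterated difference.
    Δ-evaluate : ∀ cs (Fs : List (Form cs)) → length Fs ≡ length cs →
      Δ (length cs) (evaluate Fs) ≡ fromℤ (permanent (map row Fs) cs) * scale cs
    -- The product rule for differences. The first bit is switched from `true` to `false` in one
    -- factor at a time; factors already switched move from `Fs` to the end of `Gs`.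
    telescope : ∀ c cs (Gs : List (Form cs)) (Fs : List (Form (c ∷ cs))) →
      length Gs ℕ.+ length Fs ≡ suc (length cs) →
      Δ (length cs) (evaluate (Gs ++ map (restrict true) Fs)) -
      Δ (length cs) (evaluate (Gs ++ map (restrict false) Fs)) ≡
      fromℤ (sumPicks (λ r rs → a r c ℤ.* permanent (map row Gs ++ rs) cs) (map row Fs)) * (d c * scale cs)

    Δ-evaluate []       []       len = refl
    Δ-evaluate (c ∷ cs) Fs       len = begin
        Δ (length cs) (evaluate Fs ∘ (true ∷_)) - Δ (length cs) (evaluate Fs ∘ (false ∷_))
      ≡⟨ cong₂ _-_ (Δ-cong (length cs) (evaluate-restrict true Fs))
                   (Δ-cong (length cs) (evaluate-restrict false Fs)) ⟩
        Δ (length cs) (evaluate (map (restrict true) Fs)) - Δ (length cs) (evaluate (map (restrict false) Fs))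
      ≡⟨ telescope c cs [] Fs len ⟩
        fromℤ (sumPicks (λ r rs → a r c ℤ.* permanent rs cs) (map row Fs)) * (d c * scale cs)
      ≡⟨ cong (λ p → fromℤ p * (d c * scale cs)) (columnExpansion (map row Fs) c cs) ⟨
        fromℤ (permanent (map row Fs) (c ∷ cs)) * (d c * scale cs)
      ∎
      where open ≡-Reasoning

    telescope c cs Gs []       len = ≡.trans (ℚₚ.+-inverseʳ (Δ (length cs) (evaluate (Gs ++ [])))) (sym (ℚₚ.*-zeroˡ (d c * scale cs)))
    telescope c cs Gs (F@(r , φ , step , _) ∷ Fs) len = begin
        D (Gs ++ F₁ ∷ Fs₁) - D (Gs ++ F₀ ∷ Fs₀)
      ≡⟨ insert-middle (D (Gs ++ F₁ ∷ Fs₁)) (D (Gs ++ F₀ ∷ Fs₁)) (D (Gs ++ F₀ ∷ Fs₀)) ⟩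
        (D (Gs ++ F₁ ∷ Fs₁) - D (Gs ++ F₀ ∷ Fs₁)) + (D (Gs ++ F₀ ∷ Fs₁) - D (Gs ++ F₀ ∷ Fs₀))
      ≡⟨ cong₂ _+_ first rest ⟩
        (fromℤ (a r c) * d c) * (fromℤ p * scale cs) + fromℤ s * (d c * scale cs)
      ≡⟨ collect (fromℤ (a r c)) (d c) (fromℤ p) (scale cs) (fromℤ s) ⟩
        (fromℤ (a r c) * fromℤ p + fromℤ s) * (d c * scale cs)
      ≡⟨ cong (_* (d c * scale cs)) (≡.trans (fromℤ-+ (a r c ℤ.* p) s) (cong (_+ fromℤ s) (fromℤ-* (a r c) p))) ⟨
        fromℤ (a r c ℤ.* p ℤ.+ s) * (d c * scale cs)
      ∎
      where
      open ≡-Reasoning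
      D : List (Form cs) → ℚ
      D = Δ (length cs) ∘ evaluate
      F₁ F₀ : Form cs
      F₁ = restrict true F
      F₀ = restrict false F
      Fs₁ Fs₀ : List (Form cs)
      Fs₁ = map (restrict true) Fs
      Fs₀ = map (restrict false) Fs
      p s : ℤ
      p = permanent (map row Gs ++ map row Fs) cs
      s = sumPicks (λ r′ rs → a r′ c ℤ.* permanent (map row Gs ++ r ∷ rs) cs) (map row Fs)
      insert-middle : ∀ x y z → x - z ≡ (x - y) + (y - z)
      insert-middle = solve-∀ ℚ-ring
      collect : ∀ x y z w s → (x * y) * (z * w) + s * (y * w) ≡ (x * z + s) * (y * w)
      collect = solve-∀ ℚ-ring
      factor : ∀ x y z → x * z ≡ (x - y) * z + y * z
      factor = solve-∀ ℚ-ring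
      cancel : ∀ x y → (x + y) - y ≡ x
      cancel = solve-∀ ℚ-ring
      first : D (Gs ++ F₁ ∷ Fs₁) - D (Gs ++ F₀ ∷ Fs₁) ≡ (fromℤ (a r c) * d c) * (fromℤ p * scale cs)
      first = begin
          D (Gs ++ F₁ ∷ Fs₁) - D (Gs ++ F₀ ∷ Fs₁)
        -- Write `φ` at `true` as its constant step plus `φ` at `false`; the second part is the term
        -- being subtracted.
        ≡⟨ cong (_- D (Gs ++ F₀ ∷ Fs₁)) (Δ-cong (length cs) λ xs → ≡.trans (evaluate-middle Gs F₁ Fs₁ xs)
             (≡.trans (factor (φ (true ∷ xs)) (φ (false ∷ xs)) (evaluate (Gs ++ Fs₁) xs))
               (cong₂ _+_ (cong (_* evaluate (Gs ++ Fs₁) xs) (step xs)) (sym (evaluate-middle Gs F₀ Fs₁ xs))))) ⟩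
          Δ (length cs) (λ xs → (fromℤ (a r c) * d c) * evaluate (Gs ++ Fs₁) xs + evaluate (Gs ++ F₀ ∷ Fs₁) xs)
            - D (Gs ++ F₀ ∷ Fs₁)
        ≡⟨ cong (_- D (Gs ++ F₀ ∷ Fs₁)) (Δ-+ (length cs) _ _) ⟩
          (Δ (length cs) (λ xs → (fromℤ (a r c) * d c) * evaluate (Gs ++ Fs₁) xs) + D (Gs ++ F₀ ∷ Fs₁))
            - D (Gs ++ F₀ ∷ Fs₁)
        ≡⟨ cancel _ (D (Gs ++ F₀ ∷ Fs₁)) ⟩
          Δ (length cs) (λ xs → (fromℤ (a r c) * d c) * evaluate (Gs ++ Fs₁) xs)
        ≡⟨ Δ-* (length cs) (fromℤ (a r c) * d c) _ ⟩
          (fromℤ (a r c) * d c) * D (Gs ++ Fs₁)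
        -- Without `F` there are as many factors as columns in `cs`, so the formula for the shorter
        -- list of columns applies.
        ≡⟨ cong ((fromℤ (a r c) * d c) *_) (Δ-evaluate cs (Gs ++ Fs₁) (≡.trans (Listₚ.length-++ Gs)
             (≡.trans (cong (length Gs ℕ.+_) (Listₚ.length-map (restrict true) Fs))
               (ℕₚ.suc-injective (≡.trans (sym (ℕₚ.+-suc (length Gs) (length Fs))) len))))) ⟩
          (fromℤ (a r c) * d c) * (fromℤ (permanent (map row (Gs ++ Fs₁)) cs) * scale cs)
        ≡⟨ cong (λ rs → (fromℤ (a r c) * d c) * (fromℤ (permanent rs cs) * scale cs))
             (≡.trans (Listₚ.map-++ row Gs Fs₁) (cong (map row Gs ++_) (rows-restrict true Fs))) ⟩
          (fromℤ (a r c) * d c) * (fromℤ p * scale cs)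
        ∎
      shift : ∀ {X : Set} (xs : List X) y zs → (xs ++ y ∷ []) ++ zs ≡ xs ++ y ∷ zs
      shift xs y zs = Listₚ.++-assoc xs (y ∷ []) zs
      rest : D (Gs ++ F₀ ∷ Fs₁) - D (Gs ++ F₀ ∷ Fs₀) ≡ fromℤ s * (d c * scale cs)
      rest = begin
          D (Gs ++ F₀ ∷ Fs₁) - D (Gs ++ F₀ ∷ Fs₀)
        ≡⟨ cong₂ (λ Hs Ks → D Hs - D Ks) (shift Gs F₀ Fs₁) (shift Gs F₀ Fs₀) ⟨
          D ((Gs ++ F₀ ∷ []) ++ Fs₁) - D ((Gs ++ F₀ ∷ []) ++ Fs₀)
        ≡⟨ telescope c cs (Gs ++ F₀ ∷ []) Fs (≡.trans (cong (ℕ._+ length Fs) (Listₚ.length-++ Gs))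
             (≡.trans (ℕₚ.+-assoc (length Gs) 1 (length Fs)) len)) ⟩
          fromℤ (sumPicks (λ r′ rs → a r′ c ℤ.* permanent (map row (Gs ++ F₀ ∷ []) ++ rs) cs) (map row Fs))
            * (d c * scale cs)
        ≡⟨ cong (λ q → fromℤ q * (d c * scale cs)) (sumPicks-cong (λ r′ rs →
             cong (λ ts → a r′ c ℤ.* permanent ts cs)
               (≡.trans (cong (_++ rs) (Listₚ.map-++ row Gs (F₀ ∷ []))) (shift (map row Gs) r rs))) (map row Fs)) ⟩
          fromℤ s * (d c * scale cs)
        ∎

  -- Common witnesses for finite families

  module Uniform {T : Set} (_⊑_ : T → T → Set) (_⊔_ : T → T → T) (bottom : T)
    (upperˡ : ∀ s t → s ⊑ (s ⊔ t)) (upperʳ : ∀ s t → t ⊑ (s ⊔ t)) where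

    Increasing : {X : Set} → (X → T → Set) → Set
    Increasing P = ∀ x {s t} → s ⊑ t → P x s → P x t

    uniformFin : ∀ r (P : Fin r → T → Set) → Increasing P → (∀ i → ∃ (P i)) → ∃[ t ] ∀ i → P i t
    uniformFin zero    P mono h = bottom , λ ()
    uniformFin (suc r) P mono h =
      let s , p = h zero
          t , q = uniformFin r (P ∘ suc) (mono ∘ suc) (h ∘ suc)
      in s ⊔ t , λ { zero    → mono zero (upperˡ s t) p
                   ; (suc i) → mono (suc i) (upperʳ s t) (q i) }

    uniformCube : ∀ k (P : Vec Bool k → T → Set) → Increasing P → (∀ xs → ∃ (P xs)) → ∃[ t ] ∀ xs → P xs t
    uniformCube zero    P mono h = proj₁ (h []) , λ { [] → proj₂ (h []) }
    uniformCube (suc k) P mono h =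
      let s , p = uniformCube k (P ∘ (true ∷_)) (mono ∘ (true ∷_)) (h ∘ (true ∷_))
          t , q = uniformCube k (P ∘ (false ∷_)) (mono ∘ (false ∷_)) (h ∘ (false ∷_))
      in s ⊔ t , λ { (true  ∷ xs) → mono (true ∷ xs) (upperˡ s t) (p xs)
                   ; (false ∷ xs) → mono (false ∷ xs) (upperʳ s t) (q xs) }

    -- Needed for two orders: the naturals, for moduli of convergence, and the rationals, for
    -- bounds.
    uniform : ∀ k r (P : Vec Bool k → Fin r → T → Set) → (∀ xs → Increasing (P xs)) →
              (∀ xs i → ∃ (P xs i)) → ∃[ t ] ∀ xs i → P xs i t
    uniform k r P mono h = uniformCube k (λ xs t → ∀ i → P xs i t)
      (λ xs s⊑t p i → mono xs i s⊑t (p i)) (λ xs → uniformFin r (P xs) (mono xs) (h xs))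

  Cauchy : (ℕ → ℚ) → Set
  Cauchy q = ∀ ε → 0ℚ < ε → ∃[ N ] ∀ m n → N ℕ.≤ m → N ℕ.≤ n → ∣ q m - q n ∣ < ε

  -- Far out in the sequences some vertex of the cube has a large product; the
  -- Cauchy property then keeps its factors away from 0 forever.
  choose-apart : ∀ {k r} (q : Vec Bool k → Fin r → ℕ → ℚ) → (∀ xs i → Cauchy (q xs i)) →
    ∀ {η N} → 0ℚ < η →
    (∀ n → N ℕ.≤ n → η ≤ ∣ Δ k (λ xs → product (map (λ i → q xs i n) (allFin r))) ∣) →
    ∃[ xs ] ∀ i → ∃[ ε ] 0ℚ < ε × ∃[ M ] ∀ n → M ℕ.≤ n → ε ≤ ∣ q xs i n ∣
  choose-apart {k} {r} q cauchy {η} {N} η>0 large =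
    xs , λ i → ½ * ε , half-pos ε>0 , n* , λ n n*≤n →
      ∣-∣-stable (q xs i n*) (q xs i n) (All.lookup (Allₚ.map⁻ away) (∈-allFin i))
        (steady xs i n* n N₂≤n* (ℕₚ.≤-trans N₂≤n* n*≤n))
    where
    module Uniformℕ = Uniform ℕ._≤_ ℕ._⊔_ 0 ℕₚ.m≤m⊔n ℕₚ.m≤n⊔m
    module Uniformℚ = Uniform ℚ._≤_ ℚ._⊔_ 0ℚ ℚₚ.p≤p⊔q ℚₚ.p≤q⊔p

    modulus : ∀ ε → 0ℚ < ε → ∃[ M ] ∀ xs i m n → M ℕ.≤ m → M ℕ.≤ n → ∣ q xs i m - q xs i n ∣ < ε
    modulus ε ε>0 = Uniformℕ.uniform k r
      (λ xs i M → ∀ m n → M ℕ.≤ m → M ℕ.≤ n → ∣ q xs i m - q xs i n ∣ < ε)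
      (λ xs i M≤M′ h m n M′≤m M′≤n → h m n (ℕₚ.≤-trans M≤M′ M′≤m) (ℕₚ.≤-trans M≤M′ M′≤n))
      (λ xs i → cauchy xs i ε ε>0)

    N₁ : ℕ
    N₁ = proj₁ (modulus 1ℚ 0<1)

    bounding : ∃[ b ] ∀ xs i → ∣ q xs i N₁ ∣ ≤ b
    bounding = Uniformℚ.uniform k r (λ xs i b → ∣ q xs i N₁ ∣ ≤ b)
      (λ xs i b≤b′ h → ℚₚ.≤-trans h b≤b′) (λ xs i → ∣ q xs i N₁ ∣ , ℚₚ.≤-refl)

    -- The summand `1ℚ` covers the movement after `N₁`; the maximum with `0ℚ` gives `1ℚ ≤ b`, as
    -- `factors-away` requires.
    b : ℚ
    b = 1ℚ + (0ℚ ℚ.⊔ proj₁ bounding)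

    1≤b : 1ℚ ≤ b
    1≤b = ℚₚ.≤-trans (ℚₚ.≤-reflexive (sym (ℚₚ.+-identityʳ 1ℚ))) (ℚₚ.+-monoʳ-≤ 1ℚ (ℚₚ.p≤p⊔q 0ℚ (proj₁ bounding)))

    bounded : ∀ xs i n → N₁ ℕ.≤ n → ∣ q xs i n ∣ ≤ b
    bounded xs i n N₁≤n = begin
      ∣ q xs i n ∣                               ≡⟨ cong ∣_∣ (cancel (q xs i n) (q xs i N₁)) ⟨
      ∣ (q xs i n - q xs i N₁) + q xs i N₁ ∣     ≤⟨ ℚₚ.∣p+q∣≤∣p∣+∣q∣ (q xs i n - q xs i N₁) (q xs i N₁) ⟩
      ∣ q xs i n - q xs i N₁ ∣ + ∣ q xs i N₁ ∣   ≤⟨ ℚₚ.+-mono-≤ (ℚₚ.<⇒≤ (proj₂ (modulus 1ℚ 0<1) xs i n N₁ N₁≤n ℕₚ.≤-refl))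
                                                     (ℚₚ.≤-trans (proj₂ bounding xs i) (ℚₚ.p≤q⊔p 0ℚ (proj₁ bounding))) ⟩
      b                                          ∎
      where
      open ℚₚ.≤-Reasoning
      cancel : ∀ p q → (p - q) + q ≡ p
      cancel = solve-∀ ℚ-ring

    big : ∃[ δ ] 0ℚ < δ × (∀ f → η ≤ ∣ Δ k f ∣ → ∃[ xs ] δ ≤ ∣ f xs ∣)
    big = Δ-large k η>0

    split : ∃[ ε ] 0ℚ < ε × (∀ vs → length vs ≡ r → All (λ v → ∣ v ∣ ≤ b) vs →
            proj₁ big ≤ ∣ product vs ∣ → All (λ v → ε ≤ ∣ v ∣) vs)
    split = factors-away 1≤b (proj₁ (proj₂ big)) r

    ε : ℚ
    ε = proj₁ split

    ε>0 : 0ℚ < ε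
    ε>0 = proj₁ (proj₂ split)

    N₂ : ℕ
    N₂ = proj₁ (modulus (½ * ε) (half-pos ε>0))

    steady : ∀ xs i m n → N₂ ℕ.≤ m → N₂ ℕ.≤ n → ∣ q xs i m - q xs i n ∣ < ½ * ε
    steady = proj₂ (modulus (½ * ε) (half-pos ε>0))

    -- Past `N` the difference is large, past `N₁` the factors are bounded by `b`, and past `N₂`
    -- they move by less than `½ * ε`.
    n* : ℕ
    n* = N ℕ.⊔ (N₁ ℕ.⊔ N₂)

    N₁≤n* : N₁ ℕ.≤ n*
    N₁≤n* = ℕₚ.≤-trans (ℕₚ.m≤m⊔n N₁ N₂) (ℕₚ.m≤n⊔m N (N₁ ℕ.⊔ N₂))

    N₂≤n* : N₂ ℕ.≤ n*
    N₂≤n* = ℕₚ.≤-trans (ℕₚ.m≤n⊔m N₁ N₂) (ℕₚ.m≤n⊔m N (N₁ ℕ.⊔ N₂))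

    chosen : ∃[ xs ] proj₁ big ≤ ∣ product (map (λ i → q xs i n*) (allFin r)) ∣
    chosen = proj₂ (proj₂ big) _ (large n* (ℕₚ.m≤m⊔n N (N₁ ℕ.⊔ N₂)))

    xs : Vec Bool k
    xs = proj₁ chosen

    away : All (λ v → ε ≤ ∣ v ∣) (map (λ i → q xs i n*) (allFin r))
    away = proj₂ (proj₂ split) (map (λ i → q xs i n*) (allFin r))
      (≡.trans (Listₚ.length-map (λ i → q xs i n*) (allFin r)) (Listₚ.length-tabulate {n = r} id))
      (Allₚ.map⁺ (All.universal (λ i → bounded xs i n* N₁≤n*) (allFin r)))
      (proj₂ chosen)

-- Choosability

module _ where
  open import Data.Rational using (_+_; _*_; _-_; _≤_; _<_; ∣_∣)

  ≃-refl : ∀ x → x ≃ x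
  ≃-refl x ε ε>0 = 0 , λ n _ → subst (_< ε) (sym (cong ∣_∣ (ℚₚ.+-inverseʳ (seq x n)))) ε>0

  difference-Cauchy : ∀ x y → Cauchy (λ n → seq x n - seq y n)
  difference-Cauchy x y ε ε>0 with cauchy x (½ * ε) (half-pos ε>0) | cauchy y (½ * ε) (half-pos ε>0)
  ... | M , p | N , q = M ℕ.⊔ N , λ m n m≥ n≥ → begin-strict
      ∣ (seq x m - seq y m) - (seq x n - seq y n) ∣
    ≡⟨ cong ∣_∣ (interchange (seq x m) (seq y m) (seq x n) (seq y n)) ⟩
      ∣ (seq x m - seq x n) - (seq y m - seq y n) ∣
    ≤⟨ ℚₚ.∣p-q∣≤∣p∣+∣q∣ (seq x m - seq x n) (seq y m - seq y n) ⟩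
      ∣ seq x m - seq x n ∣ + ∣ seq y m - seq y n ∣
    <⟨ ℚₚ.+-mono-< (p m n (ℕₚ.m⊔n≤o⇒m≤o M N m≥) (ℕₚ.m⊔n≤o⇒m≤o M N n≥))
                   (q m n (ℕₚ.m⊔n≤o⇒n≤o M N m≥) (ℕₚ.m⊔n≤o⇒n≤o M N n≥)) ⟩
      ½ * ε + ½ * ε
    ≡⟨ half+half ε ⟩
      ε
    ∎
    where
    open ℚₚ.≤-Reasoning
    interchange : ∀ a b c d → (a - b) - (c - d) ≡ (a - c) - (b - d)
    interchange = solve-∀ ℚ-ring

  module _ (G : Graph) where
    open Graph G

    -- Heads come first, so the contrast of an edge subtracts the vertex sums in the order used by
    -- `Proper`.
    standard : Orientation G
    standard = record { head = proj₁ ∘ ends ; tail = proj₂ ∘ ends ; oriented = λ _ → inj₂ refl }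

    open GraphMatrix G standard
    open Orientation standard

    -- The effect of changing one weight

    module _ {f f′ : V ⊎ E → ℝ} {c : V ⊎ E} (agree : ∀ z → z ≢ c → f z ≡ f′ z) (n : ℕ) where

      private
        δ : ℚ
        δ = seq (f c) n - seq (f′ c) n

        edgeSum : (V ⊎ E → ℝ) → List E → ℚ
        edgeSum g es = seq (sumℝ (map (g ∘ inj₂) es)) n

        edgeSum-same : ∀ {es} → All (λ e → inj₂ e ≢ c) es → edgeSum f es ≡ edgeSum f′ es
        edgeSum-same es≢c =
          cong (λ xs → seq (sumℝ xs) n) (Listₚ.map-cong-local (All.map (λ {e} → agree (inj₂ e)) es≢c))

        edgeSum-changed : ∀ {e es} → c ≡ inj₂ e → Unique es → e ∈ es → edgeSum f es - edgeSum f′ es ≡ δ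
        edgeSum-changed {es = e ∷ es} refl (e∉ ∷ _) (here refl) = ≡.trans
          (cong (λ t → (seq (f c) n + t) - (seq (f′ c) n + edgeSum f′ es))
            (edgeSum-same (All.map (λ e≢ → e≢ ∘ sym ∘ inj₂-injective) e∉)))
          (cancel (seq (f c) n) (seq (f′ c) n) (edgeSum f′ es))
          where
          cancel : ∀ x y z → (x + z) - (y + z) ≡ x - y
          cancel = solve-∀ ℚ-ring
        edgeSum-changed {es = e′ ∷ es} refl (e′∉ ∷ u) (there e∈) = ≡.trans
          (cong (λ x → (seq x n + edgeSum f es) - (seq (f′ (inj₂ e′)) n + edgeSum f′ es))
            (agree (inj₂ e′) (All.lookup e′∉ e∈ ∘ inj₂-injective)))
          (≡.trans (cancel (seq (f′ (inj₂ e′)) n) (edgeSum f es) (edgeSum f′ es))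
            (edgeSum-changed refl u e∈))
          where
          cancel : ∀ x y z → (x + y) - (x + z) ≡ y - z
          cancel = solve-∀ ℚ-ring

        edge∈edges : ∀ e → e ∈ edges
        edge∈edges e = subst (_∈ edges) (edge-index e) (∈-map⁺ edge (∈-allFin (index e)))

        edges-unique : Unique edges
        edges-unique = map⁺ (λ {i} {j} eq → ≡.trans (sym (Inverse.strictlyInverseˡ enumE i))
          (≡.trans (cong index eq) (Inverse.strictlyInverseˡ enumE j))) (allFin⁺ ∣E∣)

        star : V → List E
        star v = filter (incident? v) edges

        same⇒zero : ∀ {x y t} → x ≡ y → t ≡ 0ℤ → x - y ≡ fromℤ t * δ
        same⇒zero {x} refl refl = ≡.trans (ℚₚ.+-inverseʳ x) (sym (ℚₚ.*-zeroˡ δ))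

        changed⇒one : ∀ {x t} → x ≡ δ → t ≡ 1ℤ → x ≡ fromℤ t * δ
        changed⇒one refl refl = sym (ℚₚ.*-identityˡ δ)

      -- The vertex sum is linear with coefficients `touch`; an edge is counted once since `star v`
      -- has no repetitions. Addition of reals is termwise, so the identity is exact at every index
      -- `n`.
      vertexSum-difference : ∀ v →
        seq (vertexSum G f v) n - seq (vertexSum G f′ v) n ≡ fromℤ (touch v c) * δ
      vertexSum-difference v = go c refl
        where
        cancelʳ : ∀ x y z → (x + z) - (y + z) ≡ x - y
        cancelʳ = solve-∀ ℚ-ring
        cancelˡ : ∀ x y z → (x + y) - (x + z) ≡ y - z
        cancelˡ = solve-∀ ℚ-ring
        Goal : V ⊎ E → Set
        Goal z = seq (vertexSum G f v) n - seq (vertexSum G f′ v) n ≡ fromℤ (touch v z) * δ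
        vertexCase : ∀ u → c ≡ inj₁ u → Dec (u ≡ v) → Goal (inj₁ u)
        vertexCase u refl (yes refl) = changed⇒one (≡.trans
          (cong (λ t → (seq (f c) n + t) - (seq (f′ c) n + edgeSum f′ (star v)))
            (edgeSum-same (All.universal (λ _ ()) (star v))))
          (cancelʳ (seq (f c) n) (seq (f′ c) n) (edgeSum f′ (star v))))
          (indicator-yes (u ≟V v) refl)
        vertexCase u refl (no u≢v) = same⇒zero (cong₂ _+_
          (cong (λ x → seq x n) (agree (inj₁ v) (u≢v ∘ sym ∘ inj₁-injective)))
          (edgeSum-same (All.universal (λ _ ()) (star v))))
          (indicator-no (u ≟V v) u≢v)
        edgeCase : ∀ e → c ≡ inj₂ e → Dec (Incident v e) → Goal (inj₂ e)
        edgeCase e refl (yes inc) = changed⇒one (≡.trans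
          (cong (λ x → (seq x n + edgeSum f (star v)) - (seq (f′ (inj₁ v)) n + edgeSum f′ (star v)))
            (agree (inj₁ v) λ ()))
          (≡.trans (cancelˡ (seq (f′ (inj₁ v)) n) (edgeSum f (star v)) (edgeSum f′ (star v)))
            (edgeSum-changed refl (filter⁺ (incident? v) edges-unique)
              (∈-filter⁺ (incident? v) (edge∈edges e) inc))))
          (indicator-yes (incident? v e) inc)
        edgeCase e refl (no ¬inc) = same⇒zero (cong₂ _+_
          (cong (λ x → seq x n) (agree (inj₁ v) λ ()))
          (edgeSum-same (All.tabulate λ { e∈ refl → ¬inc (proj₂ (∈-filter⁻ (incident? v) {xs = edges} e∈)) })))
          (indicator-no (incident? v e) ¬inc)
        go : ∀ z → c ≡ z → Goal z
        go (inj₁ u) eq = vertexCase u eq (u ≟V v)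
        go (inj₂ e) eq = edgeCase e eq (incident? v e)

    contrast : (V ⊎ E → ℝ) → Fin ∣E∣ → ℕ → ℚ
    contrast f i n = seq (vertexSum G f (head (edge i))) n - seq (vertexSum G f (tail (edge i))) n

    contrast-difference : ∀ {f f′ : V ⊎ E → ℝ} {c} → (∀ z → z ≢ c → f z ≡ f′ z) → ∀ i n →
      contrast f i n - contrast f′ i n ≡ fromℤ (A i c) * (seq (f c) n - seq (f′ c) n)
    contrast-difference {f} {f′} {c} agree i n = begin
        contrast f i n - contrast f′ i n
      ≡⟨ interchange (φ f h) (φ f t) (φ f′ h) (φ f′ t) ⟩
        (φ f h - φ f′ h) - (φ f t - φ f′ t)
      ≡⟨ cong₂ _-_ (vertexSum-difference agree n h) (vertexSum-difference agree n t) ⟩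
        fromℤ (touch h c) * δ - fromℤ (touch t c) * δ
      ≡⟨ factor (fromℤ (touch h c)) (fromℤ (touch t c)) δ ⟩
        (fromℤ (touch h c) - fromℤ (touch t c)) * δ
      ≡⟨ cong (_* δ) (≡.trans (cong fromℤ (A-touch i c))
           (≡.trans (fromℤ-+ (touch h c) (ℤ.- touch t c))
             (cong (fromℤ (touch h c) +_) (fromℤ-neg (touch t c))))) ⟨
        fromℤ (A i c) * δ
      ∎
      where
      open ≡-Reasoning
      h = head (edge i)
      t = tail (edge i)
      δ = seq (f c) n - seq (f′ c) n
      φ : (V ⊎ E → ℝ) → V → ℚ
      φ g v = seq (vertexSum G g v) n
      interchange : ∀ a b c d → (a - b) - (c - d) ≡ (a - c) - (b - d)
      interchange = solve-∀ ℚ-ring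
      factor : ∀ x y z → x * z - y * z ≡ (x - y) * z
      factor = solve-∀ ℚ-ring

    -- Weightings indexed by the Boolean cube

    set : V ⊎ E → Bool → (V ⊎ E → Bool) → V ⊎ E → Bool
    set c b σ z = if does (z ≟VE c) then b else σ z

    set-at : ∀ c b σ → set c b σ c ≡ b
    set-at c b σ with c ≟VE c
    ... | yes _  = refl
    ... | no c≢c = contradiction refl c≢c

    set-off : ∀ {c b σ z} → z ≢ c → set c b σ z ≡ σ z
    set-off {c} {z = z} z≢c with z ≟VE c
    ... | yes z≡c = contradiction z≡c z≢c
    ... | no _    = refl

    -- The head of the list is written first, which follows the recursion of `Δ` and `Affine`;
    -- without repetitions nothing is overwritten later.
    bits : (cs : List (V ⊎ E)) → Vec Bool (length cs) → (V ⊎ E → Bool) → V ⊎ E → Bool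
    bits []       []       σ = σ
    bits (c ∷ cs) (b ∷ bs) σ = bits cs bs (set c b σ)

    bits-off : ∀ {cs c} → c ∉ cs → ∀ bs σ → bits cs bs σ c ≡ σ c
    bits-off {[]}      c∉ []       σ = refl
    bits-off {c′ ∷ cs} c∉ (b ∷ bs) σ =
      ≡.trans (bits-off (c∉ ∘ there) bs (set c′ b σ)) (set-off {c′} {b} {σ} (c∉ ∘ here))

    bits-agree : ∀ cs bs {σ σ′ z} → σ z ≡ σ′ z → bits cs bs σ z ≡ bits cs bs σ′ z
    bits-agree []       []       eq = eq
    bits-agree (c ∷ cs) (b ∷ bs) {z = z} eq =
      bits-agree cs bs (cong (λ t → if does (z ≟VE c) then b else t) eq)

    -- Only the weights in `cs` vary, each over the two elements of its list. The alternating sum of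
    -- the products of contrasts over this cube stays away from 0, and `choose-apart` finds a point
    -- of the cube at which every contrast does.
    transversal⇒Choosable : Transversal → Choosable G 2 2
    transversal⇒Choosable (cs , unique , p≢0) L L′ =
      f xs , proper , (λ v → option∈L v (bits cs xs (λ _ → false) (inj₁ v)))
      , λ e → option∈L′ e (bits cs xs (λ _ → false) (inj₂ e))
      where
      option : V ⊎ E → Bool → ℝ
      option (inj₁ v) false = element (L v) zero
      option (inj₁ v) true  = element (L v) (suc zero)
      option (inj₂ e) false = element (L′ e) zero
      option (inj₂ e) true  = element (L′ e) (suc zero)

      options-apart : ∀ z → option z true # option z false
      options-apart (inj₁ v) = distinct (L v) (suc zero) zero λ ()
      options-apart (inj₂ e) = distinct (L′ e) (suc zero) zero λ ()

      option∈L : ∀ v b → option (inj₁ v) b ∈ℝ L v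
      option∈L v false = zero , ≃-refl (element (L v) zero)
      option∈L v true  = suc zero , ≃-refl (element (L v) (suc zero))

      option∈L′ : ∀ e b → option (inj₂ e) b ∈ℝ L′ e
      option∈L′ e false = zero , ≃-refl (element (L′ e) zero)
      option∈L′ e true  = suc zero , ≃-refl (element (L′ e) (suc zero))

      select : (V ⊎ E → Bool) → V ⊎ E → ℝ
      select σ z = option z (σ z)

      f : Vec Bool (length cs) → V ⊎ E → ℝ
      -- Outside `cs` the default `false` picks the first element of the list.
      f xs = select (bits cs xs λ _ → false)

      gap : ℕ → V ⊎ E → ℚ
      gap n z = seq (option z true) n - seq (option z false) n

      -- Two assignments that differ at `c` alone have contrasts differing by `A i c` times the gap.
      -- By uniqueness the remaining bits leave the choice at `c` alone.
      affine : ∀ n i ds → Unique ds → ∀ σ →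
        Nullstellensatz.Affine A (gap n) i ds (λ bs → contrast (select (bits ds bs σ)) i n)
      affine n i []       u       σ = tt
      affine n i (c ∷ ds) u@(_ ∷ u′) σ =
        (λ bs → ≡.trans
          (contrast-difference
            {select (bits ds bs (set c true σ))} {select (bits ds bs (set c false σ))} {c}
            (λ z z≢c → cong (option z) (bits-agree ds bs
              (≡.trans (set-off {c} {true} {σ} z≢c) (sym (set-off {c} {false} {σ} z≢c))))) i n)
          (cong₂ (λ b b′ → fromℤ (A i c) * (seq (option c b) n - seq (option c b′) n))
            (≡.trans (bits-off (Unique[x∷xs]⇒x∉xs u) bs (set c true σ)) (set-at c true σ))
            (≡.trans (bits-off (Unique[x∷xs]⇒x∉xs u) bs (set c false σ)) (set-at c false σ))))
        , λ b → affine n i ds u′ (set c b σ)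

      Δ-contrasts : ∀ n → Δ (length cs) (λ xs → product (map (λ i → contrast (f xs) i n) (allFin ∣E∣))) ≡
                          fromℤ (permanent (allFin ∣E∣) cs) * product (map (gap n) cs)
      Δ-contrasts n = ≡.trans (Δ-cong (length cs) λ xs → cong product (Listₚ.map-∘ (allFin ∣E∣)))
        (≡.trans (Δ-evaluate cs forms
          (≡.trans (Listₚ.length-map form (allFin ∣E∣)) (sym (permanent-length (allFin ∣E∣) cs p≢0))))
          (cong (λ is → fromℤ (permanent is cs) * product (map (gap n) cs))
            (≡.trans (sym (Listₚ.map-∘ (allFin ∣E∣))) (Listₚ.map-id (allFin ∣E∣)))))
        where
        open Nullstellensatz A (gap n)
        form : Fin ∣E∣ → Form cs
        form i = i , (λ xs → contrast (f xs) i n) , affine n i cs unique λ _ → false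
        forms : List (Form cs)
        forms = map form (allFin ∣E∣)

      -- Apartness bounds each gap below by a positive rational from some index on, and these bounds
      -- multiply.
      gaps-apart : ∀ (ds : List (V ⊎ E)) → ∃[ η ] 0ℚ < η × ∃[ N ] ∀ n → N ℕ.≤ n → η ≤ ∣ product (map (gap n) ds) ∣
      gaps-apart []       = 1ℚ , ℚₚ.positive⁻¹ 1ℚ , 0 , λ _ _ → ℚₚ.≤-refl
      gaps-apart (c ∷ ds) with options-apart c | gaps-apart ds
      ... | ε , ε>0 , M , p | η , η>0 , N , q = ε * η , *-pos ε>0 η>0 , M ℕ.⊔ N , λ n n≥ →
        ℚₚ.≤-trans (*-mono-≤ (ℚₚ.<⇒≤ ε>0) (p n (ℕₚ.m⊔n≤o⇒m≤o M N n≥)) (ℚₚ.<⇒≤ η>0) (q n (ℕₚ.m⊔n≤o⇒n≤o M N n≥)))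
          (ℚₚ.≤-reflexive (sym (ℚₚ.∣p*q∣≡∣p∣*∣q∣ (gap n c) (product (map (gap n) ds)))))

      large : ∃[ η ] 0ℚ < η × ∃[ N ] ∀ n → N ℕ.≤ n →
        η ≤ ∣ Δ (length cs) (λ xs → product (map (λ i → contrast (f xs) i n) (allFin ∣E∣))) ∣
      large = let η , η>0 , N , h = gaps-apart cs in η , η>0 , N , λ n N≤n → begin
          η
        ≡⟨ ℚₚ.*-identityˡ η ⟨
          1ℚ * η
        -- The permanent is a nonzero integer, hence at least 1 in absolute value.
        ≤⟨ *-mono-≤ (ℚₚ.nonNegative⁻¹ 1ℚ) (1≤∣fromℤ∣ (permanent (allFin ∣E∣) cs) p≢0) (ℚₚ.<⇒≤ η>0) (h n N≤n) ⟩
          ∣ fromℤ (permanent (allFin ∣E∣) cs) ∣ * ∣ product (map (gap n) cs) ∣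
        ≡⟨ ℚₚ.∣p*q∣≡∣p∣*∣q∣ (fromℤ (permanent (allFin ∣E∣) cs)) (product (map (gap n) cs)) ⟨
          ∣ fromℤ (permanent (allFin ∣E∣) cs) * product (map (gap n) cs) ∣
        ≡⟨ cong ∣_∣ (Δ-contrasts n) ⟨
          ∣ Δ (length cs) (λ xs → product (map (λ i → contrast (f xs) i n) (allFin ∣E∣))) ∣
        ∎
        where open ℚₚ.≤-Reasoning

      solution : ∃[ xs ] ∀ i → ∃[ ε ] 0ℚ < ε × ∃[ M ] ∀ n → M ℕ.≤ n → ε ≤ ∣ contrast (f xs) i n ∣
      solution = let η , η>0 , N , h = large in choose-apart (λ xs → contrast (f xs))
        (λ xs i → difference-Cauchy (vertexSum G (f xs) (head (edge i))) (vertexSum G (f xs) (tail (edge i))))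
        {η} {N} η>0 h

      xs : Vec Bool (length cs)
      xs = proj₁ solution

      proper : Proper G (f xs)
      proper e = subst (λ e → vertexSum G (f xs) (proj₁ (ends e)) # vertexSum G (f xs) (proj₂ (ends e)))
        (edge-index e) (proj₂ solution (index e))

open import Data.Nat using (_≤_)

corollary5 : ∀ (n m : ℕ) → 1 ≤ n → 1 ≤ m → Pind (grid n m) 1 × Choosable (grid n m) 2 2
corollary5 (suc n) (suc m) _ _ =
    transversal⇒Pind (grid (suc n) (suc m)) (gridTransversal n m)
  , transversal⇒Choosable (grid (suc n) (suc m)) (gridTransversal n m (standard (grid (suc n) (suc m))))
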